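{- For infinitely many positive integers $g$, there exists a graph of Euler genus $g$ that has no $\left(2,2,\left\lceil\frac{g-30}{28}\right\rceil\right)$-coloring.
   Context: All graphs are finite and simple (no loops, no multiple edges). For integers $d_1,\ldots,d_k$, a $(d_1,\ldots,d_k)$-coloring of a graph $G$ is an assignment to each vertex of a color from $\{1,\ldots,k\}$ such that for each $i$, every vertex colored $i$ has at most $d_i$ neighbors colored $i$. A surface is a non-null compact connected 2-manifold without boundary. The Euler genus of a surface is $2h$ if it is the orientable surface obtained from the sphere by adding $h\ge 0$ handles, and $k$ if it is the non-orientable surface obtained from the sphere by adding $k\ge 1$ cross-caps. The Euler genus of a graph is the minimum Euler genus of a surface in which the graph embeds. -}

module Defs where

open import Data.Bool.Base using (Bool; not)
open import Data.Fin.Base using (Fin)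
open import Data.Fin.Patterns using (0F; 1F; 2F)
open import Data.Fin.Properties using (_≟_)
open import Data.Integer.Base as ℤ using (ℤ; +_)
open import Data.List.Base using (allFin; filter; length)
open import Data.Nat.Base using (ℕ; NonZero; _*_; _≤_)
open import Data.Product.Base using (∃-syntax; Σ-syntax; _×_)
open import Data.Vec.Base using (Vec; lookup)
open import Function.Bundles using (_⇔_)
open import Function.Definitions using (Injective; Surjective)
open import Level using (0ℓ)
open import Relation.Binary.Construct.Closure.ReflexiveTransitive using (Star)
open import Relation.Binary.Core using (Rel)
open import Relation.Binary.Definitions using (Decidable; Symmetric)
open import Relation.Binary.PropositionalEquality.Core using (_≡_; _≢_)
open import Relation.Nullary.Decidable.Core using (_×-dec_)
open import Relation.Nullary.Negation.Core using (¬_)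

------------------------------------------------------------------------
-- Finite simple graphs and defective colorings

record Graph : Set₁ where
  field
    order       : ℕ
    Adj         : Rel (Fin order) 0ℓ
    adj?        : Decidable Adj
    symmetric   : Symmetric Adj
    irreflexive : ∀ v → ¬ Adj v v

module _ (G : Graph) where
  open Graph G

  likeNeighbours : ∀ {k} → (Fin order → Fin k) → Fin order → ℕ
  likeNeighbours c v =
    length (filter (λ w → adj? v w ×-dec (c w ≟ c v)) (allFin order))

  -- The dᵢ are arbitrary integers; a color with dᵢ < 0 cannot be used.
  IsColoring : ∀ {k} → Vec ℤ k → (Fin order → Fin k) → Set
  IsColoring d c = ∀ v → + likeNeighbours c v ℤ.≤ lookup d (c v)

  Colorable : ∀ {k} → Vec ℤ k → Set
  Colorable {k} d = ∃[ c ] IsColoring {k} d c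

------------------------------------------------------------------------
-- Surfaces

data Surface : Set where
  sphereWithHandles   : (h : ℕ) → Surface
  sphereWithCrossCaps : (k : ℕ) → .{{NonZero k}} → Surface

eulerGenus : Surface → ℕ
eulerGenus (sphereWithHandles h)   = 2 * h
eulerGenus (sphereWithCrossCaps k) = k

-- A decomposition of a nonempty connected closed surface into vertices,
-- open edges and open disks, given by its flags (the triangles of the
-- barycentric subdivision).  τ i x is the flag sharing with x all but its
-- cell of dimension i: it is the triangle on the other side of the side of
-- x opposite to the barycentre of that cell.  As the surface has no
-- boundary, τ i has no fixed points; the laws relating τ 0 and τ 2 say that
-- each edge is made of four flags.  Loops and parallel edges are allowed.
record Map : Set where
  field
    flags      : ℕ
    nonEmpty   : NonZero flags
    τ          : Fin 3 → Fin flags → Fin flags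
    involutive : ∀ i x → τ i (τ i x) ≡ x
    fixedFree  : ∀ i x → τ i x ≢ x
    commute    : ∀ x → τ 0F (τ 2F x) ≡ τ 2F (τ 0F x)
    fourFlags  : ∀ x → τ 0F x ≢ τ 2F x
    connected  : ∀ x y → Star (λ u v → ∃[ i ] τ i u ≡ v) x y

  -- A cell of dimension i is the set of flags reachable from a given one
  -- without using τ i.
  SameCell : Fin 3 → Rel (Fin flags) 0ℓ
  SameCell i = Star (λ u v → ∃[ j ] j ≢ i × τ j u ≡ v)

  -- A numbering of the cells of each dimension, unique up to permutation.
  field
    cells      : Fin 3 → ℕ
    cell       : ∀ i → Fin flags → Fin (cells i)
    surjective : ∀ i → Surjective _≡_ _≡_ (cell i)
    sameCell   : ∀ i x y → cell i x ≡ cell i y ⇔ SameCell i x y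

  χ : ℤ
  χ = + cells 0F ℤ.- + cells 1F ℤ.+ + cells 2F

  Orientable : Set
  Orientable = Σ[ o ∈ (Fin flags → Bool) ] (∀ i x → o (τ i x) ≡ not (o x))

-- Closed surfaces are classified by orientability and Euler characteristic;
-- each handle lowers the latter by 2 and each cross-cap by 1.
_IsMapOn_ : Map → Surface → Set
M IsMapOn sphereWithHandles h   =
  Map.Orientable M × Map.χ M ≡ + 2 ℤ.- + (2 * h)
M IsMapOn sphereWithCrossCaps k =
  ¬ Map.Orientable M × Map.χ M ≡ + 2 ℤ.- + k

------------------------------------------------------------------------
-- Embeddings

-- G, being simple, is isomorphic to a subgraph of the graph of M; distinct
-- edges of G automatically go to distinct edges of M.
record _IsSubgraphOf_ (G : Graph) (M : Map) : Set where
  open Graph G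
  open Map M
  field
    vertex    : Fin order → Fin (cells 0F)
    injective : Injective _≡_ _≡_ vertex
    edge      : ∀ u v → Adj u v →
                ∃[ x ] cell 0F x ≡ vertex u × cell 0F (τ 0F x) ≡ vertex v

-- Embeddings need not be cellular, and G need not be connected: a drawing
-- of G on S without crossings can be completed, by adding vertices and edges
-- inside its faces, to a decomposition of S whose graph contains G.
_EmbedsIn_ : Graph → Surface → Set
G EmbedsIn S = ∃[ M ] M IsMapOn S × G IsSubgraphOf M

HasEulerGenus : Graph → ℕ → Set
HasEulerGenus G g =
  (∃[ S ] G EmbedsIn S × eulerGenus S ≡ g) ×
  (∀ S → G EmbedsIn S → g ≤ eulerGenus S)

{-# OPTIONS --safe #-}

-- A simple graph with n vertices and e edges on a surface of Euler genus g
-- has e ≤ 3n − 6 + 3g, with equality for a triangulation; so a triangulation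
-- realises the Euler genus of its graph.  The graph used here is a
-- triangulation: start with K₇ on the torus and, in a triangle at each of its
-- seven vertices h, insert one after the other m tiles, pieces of Euler genus
-- 4 (namely K₈, with a few extra vertices) in which h is joined to another
-- K₇.  Its Euler genus is 28m + 2.  In a (2,2,d)-coloring every K₇ has a
-- vertex of the third color, as four vertices of one of the first two colors
-- would have three like neighbours each.  So some h has the third color, and
-- so does a neighbour of h in each of its m tiles, whence d ≥ m.  But
-- ⌈(28m + 2 − 30)/28⌉ = m − 1.
--
-- For the inequality, let G be a subgraph of the graph of a map.  Choose a
-- maximal forest T in the dual graph among the edges outside G; its
-- components are the regions, r = F − |T| in number.  Counting flags modulo 2
-- shows that the edges outside T connect all vertices, hence at least V − n of
-- them are not in G, and E − |T| − e ≥ V − n.  It also shows that the boundary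
-- of a region has even degree at every vertex, so that it has at least three
-- edges, and 3r ≤ 2e, unless r = 1.
module Submission where

open import Defs
open import Algebra.Bundles using (CommutativeRing)
import Algebra.Properties.CommutativeMonoid.Sum
open import Data.Bool.Base using (Bool; true; false; not; _∧_; _∨_; _xor_)
open import Data.Bool.Properties as Bool
  using (xor-∧-commutativeRing; xor-same; xor-identityʳ; ¬-not; ∧-comm)
open import Data.Empty using (⊥; ⊥-elim)
open import Data.Fin using (#_)
open import Data.Fin.Base as Fin
  using (Fin; zero; suc; toℕ; punchIn; punchOut; splitAt; _↑ˡ_; _↑ʳ_)
open import Data.Fin.Patterns
open import Data.Fin.Permutation using (permutation)
open import Data.Fin.Properties as Fin
  using (_≟_; any?; all?; _<?_; injective⇒≤; punchOut-cong; punchInᵢ≢i; punchOut-punchIn;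
         +↔⊎; *↔×; 0↔⊥; 1↔⊤; 2↔Bool)
open import Data.Integer.Base as ℤ using (+_)
import Data.Integer.Properties as ℤ
open import Data.Integer.Solver using () renaming (module +-*-Solver to ℤ-Solver)
open import Data.List.Base as List using (List; []; _∷_; _++_; allFin; filter; length)
import Data.List.Membership.DecPropositional as DecMembership
open import Data.List.Membership.Propositional using (_∈_; _∉_)
open import Data.List.Membership.Propositional.Properties
  using (∈-filter⁺; ∈-allFin; ∈-++⁺ˡ; ∈-++⁺ʳ; ∈-map⁺)
open import Data.List.Properties using (length-tabulate; length-++; length-map)
open import Data.List.Relation.Unary.Any using (here; there; index)
open import Data.List.Relation.Unary.Any.Properties using (lookup-index)
open import Data.Nat.Base as ℕ using (ℕ; zero; suc; _+_; _*_; _≤_; _<_; z≤n; s≤s)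
open import Data.Nat.DivMod as ℕ using (_mod_)
import Data.Nat.Properties as ℕ
open import Data.Nat.Solver using () renaming (module +-*-Solver to ℕ-Solver)
open import Data.Product.Algebra using (×-distribʳ-⊎)
open import Data.Product.Base
  using (∃; ∃-syntax; Σ-syntax; _×_; _,_; proj₁; proj₂; map; map₁; uncurry)
open import Data.Product.Function.NonDependent.Propositional using (_×-↔_)
open import Data.Product.Properties using (≡-dec; ,-injective)
open import Data.Rational.Unnormalised.Base using (ceiling; _/_)
open import Data.Sum.Base as Sum using (_⊎_; inj₁; inj₂)
open import Data.Sum.Function.Propositional using (_⊎-↔_)
import Data.Sum.Properties as Sum
open import Data.Unit.Base using (⊤; tt)
open import Data.Vec.Base as Vec using (Vec; _∷_; []; lookup)
import Data.Vec.Properties as Vec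
open import Function.Base using (_∘_; id; flip; case_of_)
open import Function.Bundles using (Equivalence; Inverse; Injection; _↔_; _↣_; mk↔ₛ′; mk↣; mk⇔)
open import Function.Construct.Composition using (_↣-∘_; _↔-∘_)
open import Function.Construct.Identity using (↔-id)
open import Function.Construct.Symmetry using (↔-sym)
open import Function.Definitions using (Injective)
open import Function.Properties.Inverse using (↔⇒↣)
open import Level using (0ℓ)
open import Relation.Binary.Construct.Closure.ReflexiveTransitive
  using (Star; ε; _◅_; _◅◅_; gmap; reverse)
open import Relation.Binary.Definitions using (DecidableEquality; tri<; tri≈; tri>)
open import Relation.Binary.PropositionalEquality
open import Relation.Nullary using (¬_; Dec; yes; no; does; contradiction)
open import Relation.Nullary.Decidable
  using (¬?; _×-dec_; _⊎-dec_; _→-dec_; dec-true; dec-false; from-yes; map′)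
open import Relation.Unary using (Pred; Decidable)

-- Counting and parity on finite sets

-- `sum f` is the parity of the number of x with f x ≡ true.
module ⊕ = Algebra.Properties.CommutativeMonoid.Sum
  (CommutativeRing.+-commutativeMonoid xor-∧-commutativeRing)
open ⊕ using (sum)

-- Every `f i` occurs in the filtered list, and looking up its position there gives `f i` back. So
-- `i` is determined by that position, and `f` injects into the positions of the list.
length-filter-≥ : ∀ {n a} {P : Pred (Fin n) 0ℓ} (P? : Decidable P) (f : Fin a → Fin n) →
                  Injective _≡_ _≡_ f → (∀ i → P (f i)) → a ≤ length (filter P? (allFin n))
length-filter-≥ {n} P? f f-inj pf = injective⇒≤ {f = position} λ {i} {j} eq → f-inj (begin
  f i                   ≡⟨ lookup-index (member i) ⟩
  List.lookup xs (position i) ≡⟨ cong (List.lookup xs) eq ⟩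
  List.lookup xs (position j) ≡⟨ lookup-index (member j) ⟨
  f j                   ∎)
  where
  open ≡-Reasoning
  xs : List (Fin n)
  xs = filter P? (allFin n)
  member : ∀ i → f i ∈ xs
  member i = ∈-filter⁺ P? (∈-allFin (f i)) (pf i)
  position : _ → Fin (length xs)
  position i = index (member i)

length-filter-¬ : ∀ {A : Set} {P : Pred A 0ℓ} (P? : Decidable P) xs →
                  length (filter P? xs) + length (filter (¬? ∘ P?) xs) ≡ length xs
length-filter-¬ P? [] = refl
length-filter-¬ P? (x ∷ xs) with P? x
... | yes _ = cong suc (length-filter-¬ P? xs)
... | no  _ = trans (ℕ.+-suc _ _) (cong suc (length-filter-¬ P? xs))

injection-×⇒≤ : ∀ {a b c} (f : Fin a × Fin b → Fin c × Bool) → Injective _≡_ _≡_ f → a * b ≤ c * 2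
injection-×⇒≤ {a} {b} {c} f f-inj = injective⇒≤ (Injection.injective inj)
  where
  inj : Fin (a * b) ↣ Fin (c * 2)
  inj = ↔⇒↣ (↔-sym ((↔-id _ ×-↔ 2↔Bool) ↔-∘ *↔×)) ↣-∘ (mk↣ f-inj ↣-∘ ↔⇒↣ *↔×)

-- `up` keeps `f` only at the smaller member of each pair `x`, `σ x`. Thus `f` is `up` plus its
-- translate by `σ`, and the two have the same sum because `σ` is a permutation.
sum-involution : ∀ {n} (σ : Fin n → Fin n) → (∀ x → σ (σ x) ≡ x) → (∀ x → σ x ≢ x) →
                 ∀ f → (∀ x → f (σ x) ≡ f x) → sum f ≡ false
sum-involution {n} σ σσ σ≢ f fσ = begin
  sum f                     ≡⟨ ⊕.sum-cong-≗ split ⟩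
  sum (λ x → up x xor up (σ x)) ≡⟨ ⊕.∑-distrib-+ up (up ∘ σ) ⟩
  sum up xor sum (up ∘ σ)   ≡⟨ cong (sum up xor_) (⊕.sum-permute up (permutation σ σ σσ σσ)) ⟨
  sum up xor sum up         ≡⟨ xor-same (sum up) ⟩
  false                     ∎
  where
  open ≡-Reasoning
  up : Fin n → Bool
  up x = does (x <? σ x) ∧ f x
  split : ∀ x → f x ≡ up x xor up (σ x)
  split x rewrite σσ x | fσ x with Fin.<-cmp x (σ x)
  ... | tri< lt _ ≯ rewrite dec-true (x <? σ x) lt | dec-false (σ x <? x) ≯ = sym (xor-identityʳ _)
  ... | tri≈ _ eq _ = contradiction (sym eq) (σ≢ x)
  ... | tri> ≮ _ gt rewrite dec-false (x <? σ x) ≮ | dec-true (σ x <? x) gt = refl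

sum-false : ∀ {n} (f : Fin n → Bool) → (∀ x → f x ≡ false) → sum f ≡ false
sum-false {n} f all = trans (⊕.sum-cong-≗ all) (⊕.sum-replicate-zero n)

sum-unique : ∀ {n} (f : Fin n → Bool) x → f x ≡ true → (∀ y → y ≢ x → f y ≡ false) → sum f ≡ true
sum-unique {suc n} f x fx others = begin
  sum f                       ≡⟨ ⊕.sum-remove {i = x} f ⟩
  f x xor sum (f ∘ punchIn x) ≡⟨ cong₂ _xor_ fx (sum-false _ λ y → others _ (punchInᵢ≢i x y)) ⟩
  true                        ∎
  where open ≡-Reasoning

-- The form in which parity is applied: a point satisfying an even condition forces a second one, as
-- a lone one would make the sum `true`.
even⇒another : ∀ {n} (f : Fin n → Bool) → sum f ≡ false → ∀ x → f x ≡ true → ∃[ y ] y ≢ x × f y ≡ true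
even⇒another f even x fx with any? (λ y → ¬? (y ≟ x) ×-dec (f y Bool.≟ true))
... | yes found = found
... | no  none  = case trans (sym even) (sum-unique f x fx λ y y≢x → ¬-not λ fy → none (y , y≢x , fy)) of λ ()

-- Quotients of finite label sets

module Merge {r} {a b : Fin (suc r)} (a≢b : a ≢ b) where

  -- The slot of `b` is punched out, and `b` itself is sent to where `a` goes.
  merge : Fin (suc r) → Fin r
  merge x with b ≟ x
  ... | yes _  = punchOut (a≢b ∘ sym)
  ... | no b≢x = punchOut b≢x

  merge-≡ : merge a ≡ merge b
  merge-≡ with b ≟ a | b ≟ b
  ... | yes b≡a | _ = contradiction (sym b≡a) a≢b
  ... | no _ | yes _ = punchOut-cong b refl
  ... | no _ | no b≢b = contradiction refl b≢b

  merge-surjective : ∀ y → ∃[ x ] merge x ≡ y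
  merge-surjective y = punchIn b y , lemma
    where
    lemma : merge (punchIn b y) ≡ y
    lemma with b ≟ punchIn b y
    ... | yes eq = contradiction (sym eq) (punchInᵢ≢i b y)
    ... | no  _  = trans (punchOut-cong b refl) (punchOut-punchIn b)

-- `ℓ` is a surjective labelling constant on the components of the graph with edges `ps`. Each pair
-- merges at most two labels, so at least `n` minus the number of pairs remain.
identify : ∀ {n} (ps : List (Fin n × Fin n)) →
           ∃[ s ] Σ[ ℓ ∈ (Fin n → Fin s) ]
             (∀ y → ∃[ x ] ℓ x ≡ y) ×
             (∀ {p} → p ∈ ps → ℓ (proj₁ p) ≡ ℓ (proj₂ p)) ×
             n ≤ s + length ps
identify {n} [] = n , id , (λ y → y , refl) , (λ ()) , ℕ.≤-reflexive (sym (ℕ.+-identityʳ n))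
identify {n} ((x , y) ∷ ps) with identify ps
... | s , ℓ , ℓ-surj , ℓ-ps , bound with ℓ x ≟ ℓ y
... | yes eq = s , ℓ , ℓ-surj , (λ { (here refl) → eq ; (there p) → ℓ-ps p }) ,
               ℕ.≤-trans bound (ℕ.+-monoʳ-≤ s (ℕ.n≤1+n _))
... | no a≢b with s
...   | zero  = contradiction (ℓ x) λ ()
...   | suc r = r , merge ∘ ℓ ,
                (λ z → case merge-surjective z of λ (w , eq) →
                       case ℓ-surj w of λ (v , eq′) → v , trans (cong merge eq′) eq) ,
                (λ { (here refl) → merge-≡ ; (there p) → cong merge (ℓ-ps p) }) ,
                ℕ.≤-trans bound (ℕ.≤-reflexive (sym (ℕ.+-suc r _)))
  where open Merge a≢b

∧-true : ∀ {a b} → a ∧ b ≡ true → a ≡ true × b ≡ true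
∧-true {true} {true} _ = refl , refl

not-true : ∀ {a} → not a ≡ true → a ≡ false
not-true {false} _ = refl

true≢false : true ≢ false
true≢false ()

-- The edge bound

module Cellular (M : Map) where
  open Map M
  open DecMembership (_≟_ {cells 1F}) using (_∈?_)

  cell-τ : ∀ {i j} → j ≢ i → ∀ x → cell i (τ j x) ≡ cell i x
  cell-τ {i} {j} j≢i x = sym (Equivalence.from (sameCell i x (τ j x)) ((j , j≢i , refl) ◅ ε))

  cell-induction : ∀ i (P : Pred (Fin flags) 0ℓ) → (∀ j → j ≢ i → ∀ x → P x → P (τ j x)) →
                   ∀ {x y} → cell i x ≡ cell i y → P x → P y
  cell-induction i P step {x} {y} eq = walk (Equivalence.to (sameCell i x y) eq)
    where
    walk : ∀ {x y} → SameCell i x y → P x → P y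
    walk ε                      px = px
    walk ((j , j≢i , refl) ◅ s) px = walk s (step j j≢i _ px)

  v-τ₁ : ∀ x → cell 0F (τ 1F x) ≡ cell 0F x
  v-τ₁ = cell-τ λ ()
  v-τ₂ : ∀ x → cell 0F (τ 2F x) ≡ cell 0F x
  v-τ₂ = cell-τ λ ()
  f-τ₀ : ∀ x → cell 2F (τ 0F x) ≡ cell 2F x
  f-τ₀ = cell-τ λ ()
  f-τ₁ : ∀ x → cell 2F (τ 1F x) ≡ cell 2F x
  f-τ₁ = cell-τ λ ()
  v-τ₀τ₂ : ∀ x → cell 0F (τ 0F (τ 2F x)) ≡ cell 0F (τ 0F x)
  v-τ₀τ₂ x = trans (cong (cell 0F) (commute x)) (v-τ₂ _)
  f-τ₂τ₀ : ∀ x → cell 2F (τ 2F (τ 0F x)) ≡ cell 2F (τ 2F x)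
  f-τ₂τ₀ x = trans (cong (cell 2F) (sym (commute x))) (f-τ₀ _)

  -- As `τ 0F` and `τ 2F` are commuting involutions, the four listed flags are closed under both.
  edge-flags : ∀ {x y} → cell 1F x ≡ cell 1F y →
               y ≡ x ⊎ y ≡ τ 0F x ⊎ y ≡ τ 2F x ⊎ y ≡ τ 0F (τ 2F x)
  edge-flags {x} eq = cell-induction 1F P step eq (inj₁ refl)
    where
    P : Pred (Fin flags) 0ℓ
    P y = y ≡ x ⊎ y ≡ τ 0F x ⊎ y ≡ τ 2F x ⊎ y ≡ τ 0F (τ 2F x)
    step : ∀ j → j ≢ 1F → ∀ y → P y → P (τ j y)
    step 0F _ _ (inj₁ refl)                      = inj₂ (inj₁ refl)
    step 0F _ _ (inj₂ (inj₁ refl))               = inj₁ (involutive 0F x)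
    step 0F _ _ (inj₂ (inj₂ (inj₁ refl)))        = inj₂ (inj₂ (inj₂ refl))
    step 0F _ _ (inj₂ (inj₂ (inj₂ refl)))        = inj₂ (inj₂ (inj₁ (involutive 0F _)))
    step 1F 1≢1 _ _                              = contradiction refl 1≢1
    step 2F _ _ (inj₁ refl)                      = inj₂ (inj₂ (inj₁ refl))
    step 2F _ _ (inj₂ (inj₁ refl))               = inj₂ (inj₂ (inj₂ (sym (commute x))))
    step 2F _ _ (inj₂ (inj₂ (inj₁ refl)))        = inj₁ (involutive 2F x)
    step 2F _ _ (inj₂ (inj₂ (inj₂ refl)))        =
      inj₂ (inj₁ (trans (cong (τ 2F) (commute x)) (involutive 2F _)))

  rep : Fin (cells 1F) → Fin flags
  rep e = proj₁ (surjective 1F e)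

  cell-rep : ∀ e → cell 1F (rep e) ≡ e
  cell-rep e = proj₂ (surjective 1F e) refl

  -- `ℓ` is a cut of the vertex set into two sides. Like `Alike` below, which says the dual thing
  -- for faces and regions, this depends only on the edge of the flag.
  Uncut : (Fin (cells 0F) → Bool) → Pred (Fin flags) 0ℓ
  Uncut ℓ x = ℓ (cell 0F x) ≡ ℓ (cell 0F (τ 0F x))

  uncut-edge : ∀ ℓ {x y} → cell 1F x ≡ cell 1F y → Uncut ℓ x → Uncut ℓ y
  uncut-edge ℓ = cell-induction 1F (Uncut ℓ) λ where
    0F _ x u → sym (trans (cong (ℓ ∘ cell 0F) (involutive 0F x)) u)
    1F 1≢1   → contradiction refl 1≢1
    2F _ x u → trans (cong ℓ (v-τ₂ x)) (trans u (cong ℓ (sym (v-τ₀τ₂ x))))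

  Alike : ∀ {r} → (Fin (cells 2F) → Fin r) → Pred (Fin flags) 0ℓ
  Alike reg x = reg (cell 2F x) ≡ reg (cell 2F (τ 2F x))

  alike-edge : ∀ {r} (reg : Fin (cells 2F) → Fin r) {x y} → cell 1F x ≡ cell 1F y →
               Alike reg x → Alike reg y
  alike-edge reg = cell-induction 1F (Alike reg) λ where
    0F _ x a → trans (cong reg (f-τ₀ x)) (trans a (cong reg (sym (f-τ₂τ₀ x))))
    1F 1≢1   → contradiction refl 1≢1
    2F _ x a → sym (trans (cong (reg ∘ cell 2F) (involutive 2F x)) a)

  pairs : ∀ i p → (∀ x → p (τ i x) ≡ p x) → sum p ≡ false
  pairs i = sum-involution (τ i) (involutive i) (fixedFree i)

  -- Parity of the flags along the boundary of a region

  module Parity {r} (reg : Fin (cells 2F) → Fin r) (ρ : Fin r) where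

    inside : Fin flags → Bool
    inside x = does (reg (cell 2F x) ≟ ρ)

    inside-cong : ∀ {x y} → cell 2F x ≡ cell 2F y → inside x ≡ inside y
    inside-cong eq = cong (λ z → does (reg z ≟ ρ)) eq

    -- At most one of the four flags of an edge is crossing: the cut selects the end, and the region
    -- selects the side.
    crossing : (Fin (cells 0F) → Bool) → Fin flags → Bool
    crossing ℓ x = inside x ∧ ℓ (cell 0F x) ∧ not (ℓ (cell 0F (τ 0F x))) ∧ not (inside (τ 2F x))

    boundary : Fin (cells 0F) → Fin flags → Bool
    boundary w x = does (cell 0F x ≟ w) ∧ inside x ∧ not (inside (τ 2F x))

    -- Among the flags of the region on the `true` side of the cut, τ₁ pairs up
    -- all, τ₀ those on uncut edges, and τ₂ those on cut edges inside the region.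
    crossing-even : ∀ ℓ → sum (crossing ℓ) ≡ false
    crossing-even ℓ = begin
      sum (crossing ℓ)            ≡⟨ ⊕.sum-cong-≗ (λ x → split (inside x) (in-ℓ x) _ _) ⟩
      sum (λ x → p₁ x xor (p₂ x xor p₃ x)) ≡⟨ ⊕.∑-distrib-+ p₁ _ ⟩
      sum p₁ xor sum (λ x → p₂ x xor p₃ x) ≡⟨ cong₂ _xor_ (pairs 1F p₁ p₁-τ₁) (⊕.∑-distrib-+ p₂ p₃) ⟩
      sum p₂ xor sum p₃           ≡⟨ cong₂ _xor_ (pairs 0F p₂ p₂-τ₀) (pairs 2F p₃ p₃-τ₂) ⟩
      false                       ∎
      where
      open ≡-Reasoning
      in-ℓ p₁ p₂ p₃ : Fin flags → Bool
      in-ℓ x = ℓ (cell 0F x)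
      p₁ x = inside x ∧ in-ℓ x
      p₂ x = inside x ∧ in-ℓ x ∧ in-ℓ (τ 0F x)
      p₃ x = (inside x ∧ inside (τ 2F x)) ∧ in-ℓ x ∧ not (in-ℓ (τ 0F x))
      split : ∀ a b c d → a ∧ b ∧ not c ∧ not d ≡ (a ∧ b) xor ((a ∧ b ∧ c) xor ((a ∧ d) ∧ b ∧ not c))
      split false b     c     d     = refl
      split true  false c     false = refl
      split true  false c     true  = refl
      split true  true  false false = refl
      split true  true  false true  = refl
      split true  true  true  false = refl
      split true  true  true  true  = refl
      p₁-τ₁ : ∀ x → p₁ (τ 1F x) ≡ p₁ x
      p₁-τ₁ x = cong₂ _∧_ (inside-cong (f-τ₁ x)) (cong ℓ (v-τ₁ x))
      p₂-τ₀ : ∀ x → p₂ (τ 0F x) ≡ p₂ x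
      p₂-τ₀ x = cong₂ _∧_ (inside-cong (f-τ₀ x))
        (trans (cong (in-ℓ (τ 0F x) ∧_) (cong in-ℓ (involutive 0F x))) (∧-comm (in-ℓ (τ 0F x)) _))
      p₃-τ₂ : ∀ x → p₃ (τ 2F x) ≡ p₃ x
      p₃-τ₂ x = cong₂ _∧_
        (trans (cong (inside (τ 2F x) ∧_) (cong inside (involutive 2F x))) (∧-comm (inside (τ 2F x)) _))
        (cong₂ (λ a b → a ∧ not b) (cong ℓ (v-τ₂ x)) (cong ℓ (v-τ₀τ₂ x)))

    -- Among the flags of the region at `w`, `τ₁` pairs up all of them and `τ₂` those whose edge has
    -- the region on both sides. The boundary flags are the difference.
    boundary-even : ∀ w → sum (boundary w) ≡ false
    boundary-even w = begin
      sum (boundary w)            ≡⟨ ⊕.sum-cong-≗ (λ x → split (at x) (inside x) _) ⟩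
      sum (λ x → p₁ x xor p₂ x)   ≡⟨ ⊕.∑-distrib-+ p₁ p₂ ⟩
      sum p₁ xor sum p₂           ≡⟨ cong₂ _xor_ (pairs 1F p₁ p₁-τ₁) (pairs 2F p₂ p₂-τ₂) ⟩
      false                       ∎
      where
      open ≡-Reasoning
      at p₁ p₂ : Fin flags → Bool
      at x = does (cell 0F x ≟ w)
      p₁ x = at x ∧ inside x
      p₂ x = at x ∧ inside x ∧ inside (τ 2F x)
      split : ∀ a b c → a ∧ b ∧ not c ≡ (a ∧ b) xor (a ∧ b ∧ c)
      split false b     c     = refl
      split true  false c     = refl
      split true  true  c     = refl
      p₁-τ₁ : ∀ x → p₁ (τ 1F x) ≡ p₁ x
      p₁-τ₁ x = cong₂ _∧_ (cong (λ z → does (z ≟ w)) (v-τ₁ x)) (inside-cong (f-τ₁ x))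
      p₂-τ₂ : ∀ x → p₂ (τ 2F x) ≡ p₂ x
      p₂-τ₂ x = cong₂ _∧_ (cong (λ z → does (z ≟ w)) (v-τ₂ x))
        (trans (cong (inside (τ 2F x) ∧_) (cong inside (involutive 2F x))) (∧-comm (inside (τ 2F x)) _))

    inside-yes : ∀ {x} → reg (cell 2F x) ≡ ρ → inside x ≡ true
    inside-yes = dec-true (_ ≟ ρ)

    inside-no : ∀ {x} → reg (cell 2F x) ≢ ρ → inside x ≡ false
    inside-no = dec-false (_ ≟ ρ)

    inside-true : ∀ {x} → inside x ≡ true → reg (cell 2F x) ≡ ρ
    inside-true {x} eq with reg (cell 2F x) ≟ ρ
    ... | yes p = p

    inside-false : ∀ {x} → not (inside x) ≡ true → reg (cell 2F x) ≢ ρ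
    inside-false {x} eq with reg (cell 2F x) ≟ ρ
    ... | no p = p

    Boundary : Pred (Fin flags) 0ℓ
    Boundary x = reg (cell 2F x) ≡ ρ × reg (cell 2F (τ 2F x)) ≢ ρ

    boundary? : Decidable Boundary
    boundary? x = (_ ≟ ρ) ×-dec ¬? (_ ≟ ρ)

    boundary-τ₀ : ∀ {x} → Boundary x → Boundary (τ 0F x)
    boundary-τ₀ {x} (in-x , out-x) =
      trans (cong reg (f-τ₀ x)) in-x , out-x ∘ trans (cong reg (sym (f-τ₂τ₀ x)))

    boundary-unlike : ∀ {x} → Boundary x → ¬ Alike reg x
    boundary-unlike (in-x , out-x) alike = out-x (trans (sym alike) in-x)

    another-boundary : ∀ {x} → Boundary x → ∃[ y ] y ≢ x × Boundary y × cell 0F y ≡ cell 0F x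
    another-boundary {x} (in-x , out-x)
      with y , y≢x , by ← even⇒another (boundary (cell 0F x)) (boundary-even (cell 0F x)) x
             (cong₂ _∧_ (dec-true (cell 0F x ≟ cell 0F x) refl)
               (cong₂ (λ a b → a ∧ not b) (inside-yes in-x) (inside-no out-x)))
      with cell 0F y ≟ cell 0F x | by
    ... | yes at-w | in-out with in-y , out-y ← ∧-true in-out =
      y , y≢x , (inside-true in-y , inside-false out-y) , at-w
    ... | no  _    | ()

  module _ {r} (reg : Fin (cells 2F) → Fin r) (ℓ : Fin (cells 0F) → Bool) (x₀ : Fin flags) where
    open Parity reg (reg (cell 2F x₀))

    -- The flag `x₀` is crossing, so by parity there is a second crossing flag `y`. On another edge
    -- it would contradict `others`.
    cut-impossible : ¬ Alike reg x₀ →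
                     (∀ x → cell 1F x₀ ≢ cell 1F x → Alike reg x ⊎ Uncut ℓ x) →
                     ℓ (cell 0F x₀) ≡ true → ℓ (cell 0F (τ 0F x₀)) ≡ false → ⊥
    cut-impossible unlike others ℓ-x₀ ℓ-τ₀x₀
      with y , y≢x₀ , cy ← even⇒another (crossing ℓ) (crossing-even ℓ) x₀
             (cong₂ _∧_ (inside-yes refl) (cong₂ _∧_ ℓ-x₀
               (cong₂ (λ a b → not a ∧ not b) ℓ-τ₀x₀ (inside-no (unlike ∘ sym)))))
      with in-y , rest ← ∧-true cy
      with ℓ-y , rest′ ← ∧-true rest
      with ℓ-τ₀y , out-y ← ∧-true rest′
      with cell 1F x₀ ≟ cell 1F y
    ... | no e≢ = case others y e≢ of λ where
        (inj₁ alike) → inside-false out-y (trans (sym alike) (inside-true in-y))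
        (inj₂ uncut) → true≢false (trans (sym ℓ-y) (trans uncut (not-true ℓ-τ₀y)))
    -- On the edge of `x₀`, the other flags have the wrong end, the wrong side, or both.
    ... | yes eq with edge-flags eq
    ...   | inj₁ refl = y≢x₀ refl
    ...   | inj₂ (inj₁ refl) = true≢false (trans (sym ℓ-y) ℓ-τ₀x₀)
    ...   | inj₂ (inj₂ (inj₁ refl)) = unlike (sym (inside-true in-y))
    ...   | inj₂ (inj₂ (inj₂ refl)) = true≢false (trans (sym ℓ-y) (trans (cong ℓ (v-τ₀τ₂ x₀)) ℓ-τ₀x₀))

  -- If no other cut edge separates regions, then a region on one side of a cut
  -- edge x₀ has exactly one crossing flag, against parity.
  uncut-across : ∀ {r} (reg : Fin (cells 2F) → Fin r) ℓ x₀ → ¬ Alike reg x₀ →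
                 (∀ x → cell 1F x₀ ≢ cell 1F x → Alike reg x ⊎ Uncut ℓ x) → Uncut ℓ x₀
  uncut-across reg ℓ x₀ unlike others with ℓ (cell 0F x₀) in eq₀ | ℓ (cell 0F (τ 0F x₀)) in eq₁
  ... | true  | true  = refl
  ... | false | false = refl
  ... | true  | false = ⊥-elim (cut-impossible reg ℓ x₀ unlike others eq₀ eq₁)
  -- The same argument seen from the other end `τ 0F x₀`, which lies on the `true` side.
  ... | false | true  = ⊥-elim (cut-impossible reg ℓ (τ 0F x₀)
    (unlike ∘ alike-edge reg same-edge) (λ x e≢ → others x (e≢ ∘ trans same-edge)) eq₁
    (trans (cong (ℓ ∘ cell 0F) (involutive 0F x₀)) eq₀))
    where
    same-edge : cell 1F (τ 0F x₀) ≡ cell 1F x₀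
    same-edge = cell-τ (λ ()) x₀

  -- A forest of `treeSize` edges of W in the dual graph, whose components are
  -- the regions; `rest` are the other edges of W.  By `uncut`, a cut of the
  -- vertices cannot consist of edges of the forest only.
  record DualForest (W : List (Fin (cells 1F))) : Set where
    field
      regions     : ℕ
      region      : Fin (cells 2F) → Fin regions
      region-surj : ∀ ρ → ∃[ f ] region f ≡ ρ
      alike       : ∀ {e} → e ∈ W → Alike region (rep e)
      treeSize    : ℕ
      rest        : List (Fin (cells 1F))
      size-W      : length W ≡ length rest + treeSize
      size-F      : cells 2F ≡ regions + treeSize
      uncut       : ∀ ℓ → (∀ e → e ∉ W → Uncut ℓ (rep e)) → (∀ {e} → e ∈ rest → Uncut ℓ (rep e)) →
                    ∀ {e} → e ∈ W → Uncut ℓ (rep e)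

  -- The edge `e` joins two regions and so enlarges the forest. The invariant `uncut` survives
  -- because parity in the old regions makes `e` uncut first, after which `e` can be treated as an
  -- edge outside `W`.
  joinRegions : ∀ {W e} (D : DualForest W) → ¬ Alike (DualForest.region D) (rep e) → DualForest (e ∷ W)
  joinRegions {_} {e} record { regions = zero ; region = region } _ = contradiction (region (cell 2F (rep e))) λ ()
  joinRegions {W} {e} record { regions = suc r ; region = region ; region-surj = region-surj ; alike = alike
                             ; treeSize = t ; rest = rest ; size-W = size-W ; size-F = size-F ; uncut = uncut } a≢b = record
    { regions = r ; region = merge ∘ region
    ; region-surj = λ ρ → case merge-surjective ρ of λ (w , eq) →
                          case region-surj w of λ (f , eq′) → f , trans (cong merge eq′) eq
    ; alike = λ { (here refl) → merge-≡ ; (there p) → cong merge (alike p) }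
    ; treeSize = suc t ; rest = rest
    ; size-W = trans (cong suc size-W) (sym (ℕ.+-suc _ t)) ; size-F = trans size-F (sym (ℕ.+-suc r t))
    ; uncut = λ ℓ outer inner →
        let uncut-e : Uncut ℓ (rep e)
            -- An edge other than `e` either belongs to `W`, with both its faces in one old region,
            -- or lies outside `e ∷ W` and is uncut by assumption.
            uncut-e = uncut-across region ℓ (rep e) a≢b λ x e≢ → case cell 1F x ∈? W of λ where
              (yes p) → inj₁ (alike-edge region (cell-rep _) (alike p))
              (no  p) → inj₂ (uncut-edge ℓ (cell-rep _) (outer _ λ where
                (here eq) → e≢ (trans (cell-rep e) (sym eq))
                (there q) → p q))
        in λ where
          (here refl) → uncut-e
          (there p)   → uncut ℓ (λ e′ e′∉W → case e′ ≟ e of λ where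
                                   (yes refl) → uncut-e
                                   (no  e′≢e) → outer e′ λ { (here eq) → e′≢e eq ; (there q) → e′∉W q })
                                inner p
    }
    where open Merge a≢b

  -- A greedy construction, as in Kruskal's algorithm: an edge with both faces in one region goes to
  -- `rest`, any other edge merges two regions.
  dualForest : ∀ W → DualForest W
  dualForest [] = record
    { regions = cells 2F ; region = id ; region-surj = λ ρ → ρ , refl ; alike = λ ()
    ; treeSize = 0 ; rest = [] ; size-W = refl ; size-F = sym (ℕ.+-identityʳ _) ; uncut = λ _ _ _ () }
  dualForest (e ∷ W) with dualForest W
  ... | D with DualForest.region D (cell 2F (rep e)) ≟ DualForest.region D (cell 2F (τ 2F (rep e)))
  ... | no a≢b = joinRegions D a≢b
  ... | yes eq = record
    { regions = regions ; region = region ; region-surj = region-surj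
    ; alike = λ { (here refl) → eq ; (there p) → alike p }
    ; treeSize = treeSize ; rest = e ∷ rest ; size-W = cong suc size-W ; size-F = size-F
    ; uncut = λ ℓ outer inner → λ where
        (here refl) → inner (here refl)
        (there p)   → uncut ℓ (λ e′ e′∉W → case e′ ≟ e of λ where
                                 (yes refl) → inner (here refl)
                                 (no  e′≢e) → outer e′ λ { (here eq) → e′≢e eq ; (there q) → e′∉W q })
                              (inner ∘ there) p
    }
    where open DualForest D

  uncut-everywhere : ∀ ℓ → (∀ x → Uncut ℓ x) → ∀ x y → ℓ (cell 0F x) ≡ ℓ (cell 0F y)
  uncut-everywhere ℓ uncut x y = walk (connected x y)
    where
    step : ∀ i x → ℓ (cell 0F x) ≡ ℓ (cell 0F (τ i x))
    step 0F x = uncut x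
    step 1F x = cong ℓ (sym (v-τ₁ x))
    step 2F x = cong ℓ (sym (v-τ₂ x))
    walk : ∀ {x y} → Star (λ u v → ∃[ i ] τ i u ≡ v) x y → ℓ (cell 0F x) ≡ ℓ (cell 0F y)
    walk ε                = refl
    walk ((i , refl) ◅ s) = trans (step i _) (walk s)

-- Counting for an embedded simple graph

module EdgeBound
  (G : Graph) (M : Map) (sub : G IsSubgraphOf M)
  {e : ℕ} (tail head : Fin e → Fin (Graph.order G))
  (adjacent : ∀ k → Graph.Adj G (tail k) (head k))
  (distinct : ∀ {k l} → tail k ≡ tail l → head k ≡ head l → k ≡ l)
  (oriented : ∀ k l → tail k ≡ head l → head k ≢ tail l)
  where
  open Graph G
  open Map M
  open Cellular M
  open _IsSubgraphOf_ sub

  v f : _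
  v = cell 0F
  f = cell 2F

  φ : Fin e → Fin flags
  φ k = proj₁ (edge (tail k) (head k) (adjacent k))

  φ-tail : ∀ k → v (φ k) ≡ vertex (tail k)
  φ-tail k = proj₁ (proj₂ (edge _ _ (adjacent k)))

  φ-head : ∀ k → v (τ 0F (φ k)) ≡ vertex (head k)
  φ-head k = proj₂ (proj₂ (edge _ _ (adjacent k)))

  Ends : Fin e → Pred (Fin flags) 0ℓ
  Ends k x = v x ≡ vertex (tail k) × v (τ 0F x) ≡ vertex (head k) ⊎
             v x ≡ vertex (head k) × v (τ 0F x) ≡ vertex (tail k)

  ends : ∀ k {x} → cell 1F (φ k) ≡ cell 1F x → Ends k x
  ends k eq = cell-induction 1F (Ends k) step eq (inj₁ (φ-tail k , φ-head k))
    where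
    step : ∀ j → j ≢ 1F → ∀ x → Ends k x → Ends k (τ j x)
    step 0F _ x (inj₁ (p , q)) = inj₂ (q , trans (cong v (involutive 0F x)) p)
    step 0F _ x (inj₂ (p , q)) = inj₁ (q , trans (cong v (involutive 0F x)) p)
    step 1F 1≢1 _ _            = contradiction refl 1≢1
    step 2F _ x (inj₁ (p , q)) = inj₁ (trans (v-τ₂ x) p , trans (v-τ₀τ₂ x) q)
    step 2F _ x (inj₂ (p , q)) = inj₂ (trans (v-τ₂ x) p , trans (v-τ₀τ₂ x) q)

  Kept : Pred (Fin (cells 1F)) 0ℓ
  Kept c = ∃[ k ] cell 1F (φ k) ≡ c

  kept? : Decidable Kept
  kept? c = any? λ k → cell 1F (φ k) ≟ c

  unkept : List (Fin (cells 1F))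
  unkept = filter (¬? ∘ kept?) (allFin (cells 1F))

  same : ∀ {a b u w} → a ≡ vertex u → b ≡ vertex w → a ≡ b → u ≡ w
  same p q a≡b = injective (trans (sym p) (trans a≡b q))

  -- The map may have parallel edges, but the edges of `G` in it are determined by their ends:
  -- `distinct` deals with equal directions and `oriented` with opposite ones.
  simple : ∀ {k l x y} → cell 1F (φ k) ≡ cell 1F x → cell 1F (φ l) ≡ cell 1F y →
           v x ≡ v y → v (τ 0F x) ≡ v (τ 0F y) → k ≡ l
  simple {k} {l} ek el p q with ends k ek | ends l el
  ... | inj₁ (a , b) | inj₁ (c , d) = distinct (same a c p) (same b d q)
  ... | inj₁ (a , b) | inj₂ (c , d) = contradiction (same b d q) (oriented k l (same a c p))
  ... | inj₂ (a , b) | inj₁ (c , d) = contradiction (same a c p) (oriented k l (same b d q))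
  ... | inj₂ (a , b) | inj₂ (c , d) = distinct (same b d q) (same a c p)

  φ-injective : Injective _≡_ _≡_ (cell 1F ∘ φ)
  φ-injective {k} {l} eq = simple {x = φ l} {y = φ l} eq refl refl refl

  loopless : ∀ {k x} → cell 1F (φ k) ≡ cell 1F x → v x ≢ v (τ 0F x)
  loopless {k} ek p with ends k ek
  ... | inj₁ (a , b) = oriented k k loop (sym loop)
    where loop = same a b p
  ... | inj₂ (a , b) = oriented k k (sym loop) loop
    where loop = same a b p

  module Count (D : DualForest unkept) where
    open DualForest D

    unkept⁺ : ∀ {c} → ¬ Kept c → c ∈ unkept
    unkept⁺ ¬kept = ∈-filter⁺ (¬? ∘ kept?) (∈-allFin _) ¬kept

    size-E : e + (length rest + treeSize) ≤ cells 1F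
    size-E = begin
      e + (length rest + treeSize)                          ≡⟨ cong (e ℕ.+_) size-W ⟨
      e + length unkept
        ≤⟨ ℕ.+-monoˡ-≤ _ (length-filter-≥ kept? (cell 1F ∘ φ) φ-injective (_, refl)) ⟩
      length (filter kept? (allFin _)) + length unkept      ≡⟨ length-filter-¬ kept? (allFin _) ⟩
      length (allFin (cells 1F))                            ≡⟨ length-tabulate id ⟩
      cells 1F                                              ∎
      where open ℕ.≤-Reasoning

    -- Consider the cut separating the label of `z` from all others. Kept edges do not cross it
    -- since all vertices of `G` share a label, nor do edges of `rest`. By the property `uncut` of
    -- the forest no edge crosses it, and the map is connected.
    constant : ∀ {s} (ℓ : Fin (cells 0F) → Fin s) →
               (∀ {c} → c ∈ rest → ℓ (v (rep c)) ≡ ℓ (v (τ 0F (rep c)))) →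
               (∀ a b → ℓ (vertex a) ≡ ℓ (vertex b)) → ∀ y z → ℓ y ≡ ℓ z
    constant ℓ ℓ-rest ℓ-vertex y z with surjective 0F y | surjective 0F z
    ... | y′ , vy | z′ , vz = from-is-z (begin
      is-z y              ≡⟨ cong is-z (vy refl) ⟨
      is-z (v y′)         ≡⟨ uncut-everywhere is-z uncut-is-z y′ z′ ⟩
      is-z (v z′)         ≡⟨ cong is-z (vz refl) ⟩
      is-z z              ≡⟨ dec-true (ℓ z ≟ ℓ z) refl ⟩
      true                ∎)
      where
      open ≡-Reasoning
      is-z-label : Fin _ → Bool
      is-z-label u = does (u ≟ ℓ z)
      is-z : Fin (cells 0F) → Bool
      is-z = is-z-label ∘ ℓ
      from-is-z : ∀ {u} → is-z u ≡ true → ℓ u ≡ ℓ z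
      from-is-z {u} eq with ℓ u ≟ ℓ z
      ... | yes p = p
      kept-uncut : ∀ {k x} → Ends k x → Uncut is-z x
      kept-uncut (inj₁ (p , q)) = cong is-z-label (trans (cong ℓ p) (trans (ℓ-vertex _ _) (cong ℓ (sym q))))
      kept-uncut (inj₂ (p , q)) = cong is-z-label (trans (cong ℓ p) (trans (ℓ-vertex _ _) (cong ℓ (sym q))))
      outer : ∀ c → c ∉ unkept → Uncut is-z (rep c)
      outer c c∉ with kept? c
      ... | yes (k , eq) = kept-uncut (ends k (trans eq (sym (cell-rep c))))
      ... | no ¬k = contradiction (unkept⁺ ¬k) c∉
      uncut-is-z : ∀ x → Uncut is-z x
      uncut-is-z x with kept? (cell 1F x)
      ... | yes (k , eq) = kept-uncut (ends k eq)
      ... | no ¬k = uncut-edge is-z (cell-rep _)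
                      (uncut is-z outer (λ c∈ → cong is-z-label (ℓ-rest c∈)) (unkept⁺ ¬k))

    -- Identify vertices along `rest` and along a star joining the vertices of `G`. By `constant` a
    -- single class remains, so `V` is at most one plus the number of pairs, namely `length rest`
    -- plus `order` minus one.
    size-V : Fin order → cells 0F ≤ length rest + order
    size-V root = bound order vertex root (λ ℓ ℓ-rest ℓ-w → constant ℓ ℓ-rest ℓ-w)
      where
      open ℕ.≤-Reasoning
      -- The order is generalised to a variable, so that it can be matched against `suc n` and
      -- `w zero` can be the centre of the star.
      bound : ∀ n (w : Fin n → Fin (cells 0F)) → Fin n →
              (∀ {s} (ℓ : Fin (cells 0F) → Fin s) →
               (∀ {c} → c ∈ rest → ℓ (v (rep c)) ≡ ℓ (v (τ 0F (rep c)))) →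
               (∀ a b → ℓ (w a) ≡ ℓ (w b)) → ∀ y z → ℓ y ≡ ℓ z) →
              cells 0F ≤ length rest + n
      bound (suc n) w _ const = result
        where
        side spoke : List (Fin (cells 0F) × Fin (cells 0F))
        side  = List.map (λ c → v (rep c) , v (τ 0F (rep c))) rest
        spoke = List.map (λ i → w zero , w (suc i)) (allFin n)
        size : length (side ++ spoke) ≡ length rest + n
        size = trans (length-++ side)
          (cong₂ _+_ (length-map _ rest) (trans (length-map _ (allFin n)) (length-tabulate id)))
        result : cells 0F ≤ length rest + suc n
        result with identify (side ++ spoke)
        ... | s , ℓ , ℓ-surj , ℓ-ps , bd = begin
          cells 0F                    ≤⟨ bd ⟩
          s + length (side ++ spoke)  ≤⟨ ℕ.+-monoˡ-≤ _ (s≤1 s ℓ ℓ-surj all-equal) ⟩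
          suc (length (side ++ spoke)) ≡⟨ cong suc size ⟩
          suc (length rest + n)       ≡⟨ ℕ.+-suc _ n ⟨
          length rest + suc n         ∎
          where
          to-root : ∀ a → ℓ (w zero) ≡ ℓ (w a)
          to-root zero    = refl
          to-root (suc i) = ℓ-ps (∈-++⁺ʳ side (∈-map⁺ _ (∈-allFin i)))
          all-equal : ∀ y z → ℓ y ≡ ℓ z
          all-equal = const ℓ (λ c∈ → ℓ-ps (∈-++⁺ˡ (∈-map⁺ _ c∈))) λ a b → trans (sym (to-root a)) (to-root b)
          s≤1 : ∀ s (ℓ : Fin (cells 0F) → Fin s) → (∀ y → ∃[ x ] ℓ x ≡ y) → (∀ y z → ℓ y ≡ ℓ z) → s ≤ 1
          s≤1 0 _ _ _ = z≤n
          s≤1 1 _ _ _ = s≤s z≤n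
          s≤1 (suc (suc s)) ℓ surj eq with surj 0F | surj 1F
          ... | x , p | y , q = case trans (sym p) (trans (eq x y) q) of λ ()

    module _ (ρ : Fin regions) where
      open Parity region ρ

      -- Every unkept edge has both sides in one region, whether it was put in the forest or in
      -- `rest`.
      boundary-kept : ∀ {x} → Boundary x → Kept (cell 1F x)
      boundary-kept {x} bx with kept? (cell 1F x)
      ... | yes k = k
      ... | no ¬k = contradiction (alike-edge region (cell-rep _) (alike (unkept⁺ ¬k))) (boundary-unlike bx)

      -- Otherwise the common edge would be a loop or would have the region on both sides.
      next-edge : ∀ {x y} → Boundary x → Boundary y → y ≢ x → v y ≡ v x → cell 1F x ≢ cell 1F y
      next-edge {x} bx by y≢x vy≡vx eq with boundary-kept bx | edge-flags eq
      ... | _ , _ | inj₁ refl = y≢x refl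
      ... | _ , k | inj₂ (inj₁ refl) = loopless k (sym vy≡vx)
      ... | _ , _ | inj₂ (inj₂ (inj₁ refl)) = proj₂ bx (proj₁ by)
      ... | _ , k | inj₂ (inj₂ (inj₂ refl)) = loopless k (trans (sym vy≡vx) (v-τ₀τ₂ x))

      record ThreeEdges : Set where
        field
          at   : Fin 3 → Fin flags
          bd   : ∀ t → Boundary (at t)
          diff : ∀ {s t} → s ≢ t → cell 1F (at s) ≢ cell 1F (at t)

      -- Without boundary flags the region would be closed under every `τ i`, hence contain all
      -- faces, contrary to the existence of another region.
      boundary-exists : ∀ {r′} → regions ≡ suc (suc r′) → ∃ Boundary
      boundary-exists {r′} many with any? boundary?
      ... | yes found = found
      ... | no  none  with another many ρ
        where
        another : ∀ {n} → n ≡ suc (suc r′) → (ρ : Fin n) → ∃[ ρ′ ] ρ′ ≢ ρ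
        another refl zero    = suc zero , λ ()
        another refl (suc _) = zero , λ ()
      ...   | ρ′ , ρ′≢ρ with region-surj ρ | region-surj ρ′
      ...   | a , a↦ρ | b , b↦ρ′ with surjective 2F a | surjective 2F b
      ...   | x , fx | y , fy =
        contradiction (trans (sym b↦ρ′) (trans (cong region (sym (fy refl)))
          (walk (connected x y) (trans (cong region (fx refl)) a↦ρ)))) ρ′≢ρ
        where
        step : ∀ i {x} → region (f x) ≡ ρ → region (f (τ i x)) ≡ ρ
        step 0F eq = trans (cong region (f-τ₀ _)) eq
        step 1F eq = trans (cong region (f-τ₁ _)) eq
        step 2F {x} eq with region (f (τ 2F x)) ≟ ρ
        ... | yes eq′ = eq′
        ... | no  ≢ρ = contradiction (x , eq , ≢ρ) none
        walk : ∀ {x y} → Star (λ u v → ∃[ i ] τ i u ≡ v) x y → region (f x) ≡ ρ → region (f y) ≡ ρ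
        walk ε                eq = eq
        walk ((i , refl) ◅ s) eq = walk s (step i eq)

      -- Follow the boundary from `x` to its other end, on to a new boundary flag `y` there, and
      -- likewise to `z`. Consecutive edges differ by `next-edge`. The first and third differ
      -- because otherwise the edge of `y` would be a loop or parallel to that of `x`.
      three : ∃ Boundary → ThreeEdges
      three (x , bx)
            with y , y≢ , by , vy ← another-boundary (boundary-τ₀ bx)
            with z , z≢ , bz , vz ← another-boundary (boundary-τ₀ by) = record
        { at = at ; bd = bd ; diff = diff }
        where
        at : Fin 3 → Fin flags
        at 0F = x
        at 1F = y
        at 2F = z
        bd : ∀ t → Boundary (at t)
        bd 0F = bx
        bd 1F = by
        bd 2F = bz
        xy : cell 1F x ≢ cell 1F y
        xy eq = next-edge (boundary-τ₀ bx) by y≢ vy (trans (cell-τ (λ ()) x) eq)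
        yz : cell 1F y ≢ cell 1F z
        yz eq = next-edge (boundary-τ₀ by) bz z≢ vz (trans (cell-τ (λ ()) y) eq)
        back : v x ≢ v (τ 0F y)
        back vx with boundary-kept (boundary-τ₀ bx) | boundary-kept by
        ... | k , ek | l , el with simple {x = τ 0F x} {y = y} ek el (sym vy) (trans (cong v (involutive 0F x)) vx)
        ...   | refl = xy (trans (sym (cell-τ (λ ()) x)) (trans (sym ek) el))
        xz : cell 1F x ≢ cell 1F z
        xz eq with edge-flags eq
        ... | inj₁ refl = back vz
        ... | inj₂ (inj₁ refl) = loopless (proj₂ (boundary-kept by)) (trans vy vz)
        ... | inj₂ (inj₂ (inj₁ refl)) = back (trans (sym (v-τ₂ x)) vz)
        ... | inj₂ (inj₂ (inj₂ refl)) = loopless (proj₂ (boundary-kept by)) (trans vy (trans (sym (v-τ₀τ₂ x)) vz))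
        diff : ∀ {s t} → s ≢ t → cell 1F (at s) ≢ cell 1F (at t)
        diff {0F} {0F} s≢t = contradiction refl s≢t
        diff {1F} {1F} s≢t = contradiction refl s≢t
        diff {2F} {2F} s≢t = contradiction refl s≢t
        diff {0F} {1F} _ = xy
        diff {1F} {0F} _ = xy ∘ sym
        diff {1F} {2F} _ = yz
        diff {2F} {1F} _ = yz ∘ sym
        diff {0F} {2F} _ = xz
        diff {2F} {0F} _ = xz ∘ sym


    module _ (three : ∀ ρ → ThreeEdges ρ) where

      flagOf : Fin regions × Fin 3 → Fin flags
      flagOf (ρ , t) = ThreeEdges.at (three ρ) t

      region-flagOf : ∀ p → region (f (flagOf p)) ≡ proj₁ p
      region-flagOf (ρ , t) = proj₁ (ThreeEdges.bd (three ρ) t)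

      kept : ∀ p → Kept (cell 1F (flagOf p))
      kept (ρ , t) = boundary-kept ρ (ThreeEdges.bd (three ρ) t)

      edgeOf : Fin regions × Fin 3 → Fin e
      edgeOf p = proj₁ (kept p)

      -- Double counting: each edge of `G` has two sides, and the Boolean tells whether the region
      -- is the one at the flag `φ` of the edge or the one opposite.
      side : Fin regions × Fin 3 → Fin e × Bool
      side p = edgeOf p , does (region (f (φ (edgeOf p))) ≟ proj₁ p)

      Sides : Fin e → Pred (Fin (cells 2F)) 0ℓ
      Sides k c = c ≡ f (φ k) ⊎ c ≡ f (τ 2F (φ k))

      sides : ∀ {k x} → cell 1F (φ k) ≡ cell 1F x → Sides k (f x) × Sides k (f (τ 2F x))
      sides {k} ek = cell-induction 1F Both step ek (inj₁ refl , inj₂ refl)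
        where
        Both : Pred (Fin flags) 0ℓ
        Both y = Sides k (f y) × Sides k (f (τ 2F y))
        step : ∀ j → j ≢ 1F → ∀ y → Both y → Both (τ j y)
        step 0F _ y (p , q) = subst (Sides k) (sym (f-τ₀ y)) p , subst (Sides k) (sym (f-τ₂τ₀ y)) q
        step 1F 1≢1 _ _ = contradiction refl 1≢1
        step 2F _ y (p , q) = q , subst (Sides k) (cong f (sym (involutive 2F y))) p

      otherSide : ∀ p → region (f (φ (edgeOf p))) ≢ proj₁ p → region (f (τ 2F (φ (edgeOf p)))) ≡ proj₁ p
      otherSide p ≢ρ with proj₁ (sides (proj₂ (kept p)))
      ... | inj₁ eq = contradiction (trans (cong region (sym eq)) (region-flagOf p)) ≢ρ
      ... | inj₂ eq = trans (cong region (sym eq)) (region-flagOf p)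

      same-region : ∀ p q → edgeOf p ≡ edgeOf q → proj₂ (side p) ≡ proj₂ (side q) → proj₁ p ≡ proj₁ q
      same-region p q k≡l eq with region (f (φ (edgeOf p))) ≟ proj₁ p | region (f (φ (edgeOf q))) ≟ proj₁ q
      ... | yes a | yes b = trans (sym a) (trans (cong (region ∘ f ∘ φ) k≡l) b)
      ... | no a  | no b  = trans (sym (otherSide p a)) (trans (cong (region ∘ f ∘ τ 2F ∘ φ) k≡l) (otherSide q b))
      ... | yes _ | no _  = contradiction eq λ ()
      ... | no _  | yes _ = contradiction eq λ ()

      same-flag : ∀ ρ s t → edgeOf (ρ , s) ≡ edgeOf (ρ , t) → s ≡ t
      same-flag ρ s t k≡l with s ≟ t
      ... | yes eq = eq
      ... | no s≢t = contradiction
        (trans (sym (proj₂ (kept (ρ , s)))) (trans (cong (cell 1F ∘ φ) k≡l) (proj₂ (kept (ρ , t)))))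
        (ThreeEdges.diff (three ρ) s≢t)

      side-injective : ∀ {p q} → side p ≡ side q → p ≡ q
      side-injective {ρ , s} {ρ′ , t} eq =
        combine′ (same-region (ρ , s) (ρ′ , t) (cong proj₁ eq) (cong proj₂ eq)) (cong proj₁ eq)
        where
        combine′ : ∀ {ρ′} → ρ ≡ ρ′ → edgeOf (ρ , s) ≡ edgeOf (ρ′ , t) → (ρ , s) ≡ (ρ′ , t)
        combine′ refl k≡l = cong (ρ ,_) (same-flag ρ s t k≡l)

      size-regions : regions * 3 ≤ e * 2
      size-regions = injection-×⇒≤ side side-injective

    -- With two or more regions, triple the hypothesis and use that three times the number of
    -- regions is at most `2 * e`. With at most one region the hypothesis is strong enough by
    -- itself, as `order` is at least 3.
    edge-bound′ : 3 ≤ order → ∀ g → 2 + e ≤ order + regions + g → 6 + e ≤ 3 * order + 3 * g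
    edge-bound′ 3≤n g bd = by-cases regions refl
      where
      open ℕ.≤-Reasoning
      open ℕ-Solver
      few : ∀ {r} → r ≤ 1 → 2 + e ≤ order + r + g → 6 + e ≤ 3 * order + 3 * g
      few {r} r≤1 bd = begin
        4 + (2 + e)             ≤⟨ ℕ.+-monoʳ-≤ 4 bd ⟩
        4 + (order + r + g)     ≤⟨ ℕ.+-monoʳ-≤ 4 (ℕ.+-monoˡ-≤ g (ℕ.+-monoʳ-≤ order r≤1)) ⟩
        4 + (order + 1 + g)
          ≡⟨ solve 2 (λ n g → con 4 :+ (n :+ con 1 :+ g) := con 3 :+ (con 2 :+ (n :+ g))) refl order g ⟩
        -- Here 5 is bounded by twice the order.
        3 + (2 + (order + g))   ≤⟨ ℕ.+-mono-≤ 3≤n (ℕ.+-monoˡ-≤ (order + g) (ℕ.≤-trans (ℕ.n≤1+n 2) 3≤n)) ⟩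
        order + (order + (order + g))  ≤⟨ ℕ.m≤m+n _ (2 * g) ⟩
        order + (order + (order + g)) + 2 * g
          ≡⟨ solve 2 (λ n g → n :+ (n :+ (n :+ g)) :+ con 2 :* g := con 3 :* n :+ con 3 :* g) refl order g ⟩
        3 * order + 3 * g       ∎
      by-cases : ∀ r → regions ≡ r → 6 + e ≤ 3 * order + 3 * g
      by-cases 0 eq = few z≤n (subst (λ r → 2 + e ≤ order + r + g) eq bd)
      by-cases 1 eq = few ℕ.≤-refl (subst (λ r → 2 + e ≤ order + r + g) eq bd)
      by-cases (suc (suc _)) eq = ℕ.+-cancelʳ-≤ (e * 2) _ _ (begin
        6 + e + e * 2
          ≡⟨ solve 1 (λ e → con 6 :+ e :+ e :* con 2 := con 3 :* (con 2 :+ e)) refl e ⟩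
        3 * (2 + e)                         ≤⟨ ℕ.*-monoʳ-≤ 3 bd ⟩
        3 * (order + regions + g)
          ≡⟨ solve 3 (λ n r g → con 3 :* (n :+ r :+ g) := con 3 :* n :+ con 3 :* g :+ r :* con 3) refl order regions g ⟩
        3 * order + 3 * g + regions * 3     ≤⟨ ℕ.+-monoʳ-≤ _ (size-regions λ ρ → three ρ (boundary-exists ρ eq)) ⟩
        3 * order + 3 * g + e * 2           ∎)

    -- The edges in `rest` and in the forest, lost in `size-E`, are regained in `size-V` and
    -- `size-F`; so both numbers cancel from Euler's formula.
    edge-bound : 3 ≤ order → ∀ g → cells 0F + cells 2F + g ≡ 2 + cells 1F → 6 + e ≤ 3 * order + 3 * g
    edge-bound 3≤n g euler = edge-bound′ 3≤n g (ℕ.+-cancelʳ-≤ (u + t) _ _ (begin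
      2 + e + (u + t)                    ≤⟨ ℕ.+-monoʳ-≤ 2 size-E ⟩
      2 + cells 1F                       ≡⟨ euler ⟨
      cells 0F + cells 2F + g
          ≤⟨ ℕ.+-monoˡ-≤ g (ℕ.+-mono-≤ (size-V (Fin.inject≤ zero 3≤n)) (ℕ.≤-reflexive size-F)) ⟩
      u + order + (regions + t) + g
          ≡⟨ solve 5 (λ u n r t g → u :+ n :+ (r :+ t) :+ g := n :+ r :+ g :+ (u :+ t)) refl u order regions t g ⟩
      order + regions + g + (u + t)      ∎))
      where
      open ℕ.≤-Reasoning
      open ℕ-Solver
      u t : ℕ
      u = length rest
      t = treeSize

-- Triangulations as Δ-complexes

-- The corners of a triangle are 0, 1, 2; its sides are 0 = 01, 1 = 02, 2 = 12,
-- all directed upwards.  A flag is a face, a side and an end of it, `false`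
-- being the lower one.  This is consistent along edges although the directions
-- need not come from a global order of the vertices.
corner : Fin 3 → Bool → Fin 3
corner 0F false = 0F
corner 0F true  = 1F
corner 1F false = 0F
corner 1F true  = 2F
corner 2F false = 1F
corner 2F true  = 2F

turn : Fin 3 × Bool → Fin 3 × Bool
turn (0F , false) = 1F , false
turn (0F , true)  = 2F , false
turn (1F , false) = 0F , false
turn (1F , true)  = 2F , true
turn (2F , false) = 0F , true
turn (2F , true)  = 1F , true

turn-involutive : ∀ x → turn (turn x) ≡ x
turn-involutive (0F , false) = refl
turn-involutive (0F , true)  = refl
turn-involutive (1F , false) = refl
turn-involutive (1F , true)  = refl
turn-involutive (2F , false) = refl
turn-involutive (2F , true)  = refl

all-Bool? : ∀ {P : Bool → Set} → (∀ b → Dec (P b)) → Dec (∀ b → P b)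
all-Bool? P? with P? false | P? true
... | yes p | yes q = yes λ { false → p ; true → q }
... | no ¬p | _     = no λ p → ¬p (p false)
... | _     | no ¬q = no λ p → ¬q (p true)

-- Rotation around a vertex by bounded search

module Walk {A : Set} (_≟A_ : DecidableEquality A) (τ₁ τ₂ : A → A) where

  move : Bool → A → A
  move true  = τ₁
  move false = τ₂

  -- Rotation alternates between `τ₁` and `τ₂`; the Boolean says which is applied next. The result
  -- is a Boolean so that finite complexes can be checked by evaluation.
  reaches : ℕ → Bool → A → A → Bool
  reaches zero    _ x y = does (x ≟A y)
  reaches (suc n) b x y = does (x ≟A y) ∨ reaches n (not b) (move b x) y

  does-true : ∀ {x y} → does (x ≟A y) ≡ true → x ≡ y
  does-true {x} {y} eq with x ≟A y
  ... | yes p = p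

  module _ {B : Set} {R : B → B → Set} (ι : A → B) (steps : ∀ b x → Star R (ι x) (ι (move b x))) where

    -- A search in a finite model becomes a path in any complex into which `ι` carries single moves
    -- to paths.
    reaches⇒Star : ∀ n b x y → reaches n b x y ≡ true → Star R (ι x) (ι y)
    reaches⇒Star zero    b x y eq = subst (Star R (ι x) ∘ ι) (does-true eq) ε
    reaches⇒Star (suc n) b x y eq with does (x ≟A y) in here
    ... | true  = subst (Star R (ι x) ∘ ι) (does-true here) ε
    ... | false = steps b x ◅◅ reaches⇒Star n (not b) (move b x) y eq

    reachesEither⇒Star : ∀ n x y → reaches n true x y ∨ reaches n false x y ≡ true → Star R (ι x) (ι y)
    reachesEither⇒Star n x y eq with reaches n true x y in here
    ... | true  = reaches⇒Star n true x y here
    ... | false = reaches⇒Star n false x y eq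

-- The tile

-- Adding the triangles 012 and 013 gives a triangulation of the non-orientable
-- surface of Euler genus 4 with K₈ on 0, 4, …, 10, found by computer search.
-- Without them, the boundary is the quadrilateral 0, 2, 1, 3: a tile fills what
-- remains of a triangle 012 when a triangle 013 is cut out of it.  Its sides 02
-- and 12 are `outer`, its sides 03 and 13 are `port`.  The heads of its edges
-- are interior vertices, numbered from 3.
module Tile where

  data Side : Set where
    inner      : Fin 34 → Bool → Side
    outer port : Fin 2 → Side

  triangles : Vec (Vec (Fin 11) 3) 24
  triangles =
      (0F ∷ 2F ∷ 4F ∷ [])
    ∷ (0F ∷ 3F ∷ 7F ∷ [])
    ∷ (0F ∷ 4F ∷ 9F ∷ [])
    ∷ (0F ∷ 5F ∷ 6F ∷ [])
    ∷ (0F ∷ 5F ∷ # 10 ∷ [])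
    ∷ (0F ∷ 6F ∷ 8F ∷ [])
    ∷ (0F ∷ 7F ∷ 8F ∷ [])
    ∷ (0F ∷ 9F ∷ # 10 ∷ [])
    ∷ (1F ∷ 2F ∷ 4F ∷ [])
    ∷ (1F ∷ 3F ∷ 7F ∷ [])
    ∷ (1F ∷ 4F ∷ 5F ∷ [])
    ∷ (1F ∷ 5F ∷ 6F ∷ [])
    ∷ (1F ∷ 6F ∷ 7F ∷ [])
    ∷ (4F ∷ 5F ∷ 7F ∷ [])
    ∷ (4F ∷ 6F ∷ 8F ∷ [])
    ∷ (4F ∷ 6F ∷ # 10 ∷ [])
    ∷ (4F ∷ 7F ∷ # 10 ∷ [])
    ∷ (4F ∷ 8F ∷ 9F ∷ [])
    ∷ (5F ∷ 7F ∷ 9F ∷ [])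
    ∷ (5F ∷ 8F ∷ 9F ∷ [])
    ∷ (5F ∷ 8F ∷ # 10 ∷ [])
    ∷ (6F ∷ 7F ∷ 9F ∷ [])
    ∷ (6F ∷ 9F ∷ # 10 ∷ [])
    ∷ (7F ∷ 8F ∷ # 10 ∷ [])
    ∷ []

  -- Row `t` names the three sides of triangle `t`. An inner edge occurs twice, once with each
  -- Boolean; the tables `innerSides`, `outerSides` and `portSides` invert this one.
  sides : Vec (Vec Side 3) 24
  sides =
      (outer 0F ∷ inner 0F false ∷ inner (# 11) false ∷ [])
    ∷ (port 0F ∷ inner 3F false ∷ inner (# 12) false ∷ [])
    ∷ (inner 0F true ∷ inner 5F false ∷ inner (# 17) false ∷ [])
    ∷ (inner 1F false ∷ inner 2F false ∷ inner (# 19) false ∷ [])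
    ∷ (inner 1F true ∷ inner 6F false ∷ inner (# 23) false ∷ [])
    ∷ (inner 2F true ∷ inner 4F false ∷ inner (# 25) false ∷ [])
    ∷ (inner 3F true ∷ inner 4F true ∷ inner (# 28) false ∷ [])
    ∷ (inner 5F true ∷ inner 6F true ∷ inner (# 33) false ∷ [])
    ∷ (outer 1F ∷ inner 7F false ∷ inner (# 11) true ∷ [])
    ∷ (port 1F ∷ inner (# 10) false ∷ inner (# 12) true ∷ [])
    ∷ (inner 7F true ∷ inner 8F false ∷ inner (# 13) false ∷ [])
    ∷ (inner 8F true ∷ inner 9F false ∷ inner (# 19) true ∷ [])
    ∷ (inner 9F true ∷ inner (# 10) true ∷ inner (# 24) false ∷ [])
    ∷ (inner (# 13) true ∷ inner (# 15) false ∷ inner (# 20) false ∷ [])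
    ∷ (inner (# 14) false ∷ inner (# 16) false ∷ inner (# 25) true ∷ [])
    ∷ (inner (# 14) true ∷ inner (# 18) false ∷ inner (# 27) false ∷ [])
    ∷ (inner (# 15) true ∷ inner (# 18) true ∷ inner (# 30) false ∷ [])
    ∷ (inner (# 16) true ∷ inner (# 17) true ∷ inner (# 31) false ∷ [])
    ∷ (inner (# 20) true ∷ inner (# 22) false ∷ inner (# 29) false ∷ [])
    ∷ (inner (# 21) false ∷ inner (# 22) true ∷ inner (# 31) true ∷ [])
    ∷ (inner (# 21) true ∷ inner (# 23) true ∷ inner (# 32) false ∷ [])
    ∷ (inner (# 24) true ∷ inner (# 26) false ∷ inner (# 29) true ∷ [])
    ∷ (inner (# 26) true ∷ inner (# 27) true ∷ inner (# 33) true ∷ [])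
    ∷ (inner (# 28) true ∷ inner (# 30) true ∷ inner (# 32) true ∷ [])
    ∷ []

  edges : Vec (Fin 11 × Fin 8) 34
  edges =
      (0F , 1F)
    ∷ (0F , 2F)
    ∷ (0F , 3F)
    ∷ (0F , 4F)
    ∷ (0F , 5F)
    ∷ (0F , 6F)
    ∷ (0F , 7F)
    ∷ (1F , 1F)
    ∷ (1F , 2F)
    ∷ (1F , 3F)
    ∷ (1F , 4F)
    ∷ (2F , 1F)
    ∷ (3F , 4F)
    ∷ (4F , 2F)
    ∷ (4F , 3F)
    ∷ (4F , 4F)
    ∷ (4F , 5F)
    ∷ (4F , 6F)
    ∷ (4F , 7F)
    ∷ (5F , 3F)
    ∷ (5F , 4F)
    ∷ (5F , 5F)
    ∷ (5F , 6F)
    ∷ (5F , 7F)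
    ∷ (6F , 4F)
    ∷ (6F , 5F)
    ∷ (6F , 6F)
    ∷ (6F , 7F)
    ∷ (7F , 5F)
    ∷ (7F , 6F)
    ∷ (7F , 7F)
    ∷ (8F , 6F)
    ∷ (8F , 7F)
    ∷ (9F , 7F)
    ∷ []

  innerSides : Vec ((Fin 24 × Fin 3) × (Fin 24 × Fin 3)) 34
  innerSides =
      ((0F , 1F) , (2F , 0F))
    ∷ ((3F , 0F) , (4F , 0F))
    ∷ ((3F , 1F) , (5F , 0F))
    ∷ ((1F , 1F) , (6F , 0F))
    ∷ ((5F , 1F) , (6F , 1F))
    ∷ ((2F , 1F) , (7F , 0F))
    ∷ ((4F , 1F) , (7F , 1F))
    ∷ ((8F , 1F) , (# 10 , 0F))
    ∷ ((# 10 , 1F) , (# 11 , 0F))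
    ∷ ((# 11 , 1F) , (# 12 , 0F))
    ∷ ((9F , 1F) , (# 12 , 1F))
    ∷ ((0F , 2F) , (8F , 2F))
    ∷ ((1F , 2F) , (9F , 2F))
    ∷ ((# 10 , 2F) , (# 13 , 0F))
    ∷ ((# 14 , 0F) , (# 15 , 0F))
    ∷ ((# 13 , 1F) , (# 16 , 0F))
    ∷ ((# 14 , 1F) , (# 17 , 0F))
    ∷ ((2F , 2F) , (# 17 , 1F))
    ∷ ((# 15 , 1F) , (# 16 , 1F))
    ∷ ((3F , 2F) , (# 11 , 2F))
    ∷ ((# 13 , 2F) , (# 18 , 0F))
    ∷ ((# 19 , 0F) , (# 20 , 0F))
    ∷ ((# 18 , 1F) , (# 19 , 1F))
    ∷ ((4F , 2F) , (# 20 , 1F))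
    ∷ ((# 12 , 2F) , (# 21 , 0F))
    ∷ ((5F , 2F) , (# 14 , 2F))
    ∷ ((# 21 , 1F) , (# 22 , 0F))
    ∷ ((# 15 , 2F) , (# 22 , 1F))
    ∷ ((6F , 2F) , (# 23 , 0F))
    ∷ ((# 18 , 2F) , (# 21 , 2F))
    ∷ ((# 16 , 2F) , (# 23 , 1F))
    ∷ ((# 17 , 2F) , (# 19 , 2F))
    ∷ ((# 20 , 2F) , (# 23 , 2F))
    ∷ ((7F , 2F) , (# 22 , 2F))
    ∷ []

  outerSides portSides : Vec (Fin 24 × Fin 3) 2
  outerSides = (0F , 0F) ∷ (8F , 0F) ∷ []
  portSides  = (1F , 0F) ∷ (9F , 0F) ∷ []

  toSide : Fin 24 × Fin 3 → Side
  toSide (t , s) = lookup (lookup sides t) s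

  fromSide : Side → Fin 24 × Fin 3
  fromSide (inner e false) = proj₁ (lookup innerSides e)
  fromSide (inner e true)  = proj₂ (lookup innerSides e)
  fromSide (outer q)       = lookup outerSides q
  fromSide (port q)        = lookup portSides q

  _≟ˢ_ : DecidableEquality (Fin 24 × Fin 3)
  _≟ˢ_ = ≡-dec _≟_ _≟_

  abstract
    from-to : ∀ x → fromSide (toSide x) ≡ x
    from-to (t , s) = from-yes (all? λ t → all? λ s → fromSide (toSide (t , s)) ≟ˢ (t , s)) t s

  sideCode : Side → (Fin 34 × Bool) ⊎ (Fin 2 ⊎ Fin 2)
  sideCode (inner e b) = inj₁ (e , b)
  sideCode (outer q)   = inj₂ (inj₁ q)
  sideCode (port q)    = inj₂ (inj₂ q)

  sideCode-injective : ∀ {x y} → sideCode x ≡ sideCode y → x ≡ y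
  sideCode-injective {inner _ _} {inner _ _} refl = refl
  sideCode-injective {outer _}   {outer _}   refl = refl
  sideCode-injective {port _}    {port _}    refl = refl

  _≟ᶜ_ : DecidableEquality Side
  x ≟ᶜ y = map′ sideCode-injective (cong sideCode)
    (Sum.≡-dec (≡-dec _≟_ Bool._≟_) (Sum.≡-dec _≟_ _≟_) (sideCode x) (sideCode y))

  abstract
    to-from : ∀ x → toSide (fromSide x) ≡ x
    to-from (inner e false) = from-yes (all? λ e → toSide (fromSide (inner e false)) ≟ᶜ inner e false) e
    to-from (inner e true)  = from-yes (all? λ e → toSide (fromSide (inner e true)) ≟ᶜ inner e true) e
    to-from (outer q)       = from-yes (all? λ q → toSide (fromSide (outer q)) ≟ᶜ outer q) q
    to-from (port q)        = from-yes (all? λ q → toSide (fromSide (port q)) ≟ᶜ port q) q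

  glue : (Fin 24 × Fin 3) ↔ Side
  glue = mk↔ₛ′ toSide fromSide to-from from-to

  vertex : Fin 24 → Fin 3 → Fin 11
  vertex t = lookup (lookup triangles t)

  -- `inj₂ q` is the port edge from `q` to 3. Port edges count as edges of the tile, whereas the
  -- outer sides belong to the surrounding triangle.
  tail : Fin 34 ⊎ Fin 2 → Fin 11
  tail (inj₁ e) = proj₁ (lookup edges e)
  tail (inj₂ q) = q ↑ˡ 9

  head : Fin 34 ⊎ Fin 2 → Fin 8
  head (inj₁ e) = proj₂ (lookup edges e)
  head (inj₂ q) = 0F

  endOf : Side → Bool → Fin 11
  endOf (inner e _) false = tail (inj₁ e)
  endOf (inner e _) true  = 3 ↑ʳ head (inj₁ e)
  endOf (outer q)   b     = corner (suc q) b ↑ˡ 8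
  endOf (port q)    false = tail (inj₂ q)
  endOf (port q)    true  = 3 ↑ʳ head (inj₂ q)

  abstract
    ends-ok : ∀ t s b → endOf (toSide (t , s)) b ≡ vertex t (corner s b)
    ends-ok = from-yes (all? λ t → all? λ s → all-Bool? λ b →
      endOf (toSide (t , s)) b ≟ vertex t (corner s b))

  all-edges? : ∀ {P : Fin 34 ⊎ Fin 2 → Set} → (∀ e → Dec (P e)) → Dec (∀ e → P e)
  all-edges? {P} P? = map′ to (λ p i → p (splitAt 34 i)) (all? {n = 36} λ i → P? (splitAt 34 i))
    where
    to : (∀ i → P (splitAt 34 i)) → ∀ e → P e
    to p e = subst P (Fin.splitAt-join 34 2 e) (p (Fin.join 34 2 e))

  abstract
    distinct : ∀ e e′ → tail e ≡ tail e′ → head e ≡ head e′ → e ≡ e′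
    distinct = from-yes (all-edges? λ e → all-edges? λ e′ →
      (tail e ≟ tail e′) →-dec (head e ≟ head e′) →-dec Sum.≡-dec _≟_ _≟_ e e′)

  abstract
    oriented : ∀ e e′ → tail e ≡ 3 ↑ʳ head e′ → ¬ (3 ↑ʳ head e ≡ tail e′)
    oriented = from-yes (all-edges? λ e → all-edges? λ e′ →
      (tail e ≟ (3 ↑ʳ head e′)) →-dec ¬? ((3 ↑ʳ head e) ≟ tail e′))

  -- Vertex 0 is joined to 3 by the first port edge, and to 4, ..., 10 by the first seven inner
  -- edges.
  spoke : Fin 8 → Fin 34 ⊎ Fin 2
  spoke zero    = inj₂ 0F
  spoke (suc s) = inj₁ (s ↑ˡ 27)

  abstract
    tail-spoke : ∀ w → tail (spoke w) ≡ 0F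
    tail-spoke = from-yes (all? λ w → tail (spoke w) ≟ 0F)

  abstract
    head-spoke : ∀ w → head (spoke w) ≡ w
    head-spoke = from-yes (all? λ w → head (spoke w) ≟ w)

  abstract
    chord : ∀ s t → s Fin.< t → ∃[ e ] tail (inj₁ e) ≡ 4 ↑ʳ s × head (inj₁ e) ≡ suc t
    chord = from-yes (all? λ s → all? λ t → (s Fin.<? t) →-dec
      any? λ e → (tail (inj₁ e) ≟ (4 ↑ʳ s)) ×-dec (head (inj₁ e) ≟ suc t))

  Flag : Set
  Flag = Fin 24 × Fin 3 × Bool

  cross : Flag → Flag
  cross (t , s , b) with toSide (t , s)
  ... | inner e c = let (t′ , s′) = fromSide (inner e (not c)) in t′ , s′ , b
  -- Nothing lies across a boundary side of the tile, so the flag stays.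
  ... | _         = t , s , b

  turnFlag : Flag → Flag
  turnFlag (t , x) = t , turn x

  -- The anchors of 0 and 1 lie at the port, where rotation continues into the complex plugged in
  -- there; that of 2 lies on the rim of the new patch.
  anchorSide : Fin 11 → Side × Bool
  anchorSide 0F = port 0F , false
  anchorSide 1F = port 1F , false
  anchorSide 2F = outer 0F , true
  anchorSide (suc (suc (suc zero))) = port 0F , true
  anchorSide (suc (suc (suc (suc s)))) = inner (s ↑ˡ 27) false , true

  anchor : Fin 11 → Flag
  anchor u = let (c , b) = anchorSide u ; (t , s) = fromSide c in t , s , b

  open Walk {Flag} (≡-dec _≟_ (≡-dec _≟_ Bool._≟_)) turnFlag cross public

  abstract
    -- Evaluation shows that 18 moves suffice in one of the two directions of rotation.
    fan : ∀ t s b → let x = t , s , b ; y = anchor (vertex t (corner s b)) in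
          reaches 18 true x y ∨ reaches 18 false x y ≡ true
    fan = from-yes (all? λ t → all? λ s → all-Bool? λ b →
      let x = t , s , b ; y = anchor (vertex t (corner s b)) in
      (reaches 18 true x y ∨ reaches 18 false x y) Bool.≟ true)

-- Gluing triangles, and patches built from tiles

module _ {A B : Set} (i : A ↔ B) where
  to-from : ∀ y → Inverse.to i (Inverse.from i y) ≡ y
  to-from y = Inverse.inverseˡ i refl
  from-to : ∀ x → Inverse.from i (Inverse.to i x) ≡ x
  from-to x = Inverse.inverseʳ i refl

-- Each side of a face is one of the two sides of an edge or lies on the
-- boundary B.
module Gluing {F E B : Set} (glue : (F × Fin 3) ↔ ((E × Bool) ⊎ B)) where

  open Inverse glue public using () renaming (to to toSide; from to fromSide)

  Flag : Set
  Flag = F × Fin 3 × Bool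

  flag : (E × Bool) ⊎ B → Bool → Flag
  flag x b = let (f , s) = fromSide x in f , s , b

  -- A relation rather than a function: boundary sides have no step across, and a map of complexes
  -- carries steps over by applying it to the two equations.
  data Step : Flag → Flag → Set where
    around : ∀ f x → Step (f , x) (f , turn x)
    across : ∀ {f s f′ s′ e c} b → toSide (f , s) ≡ inj₁ (e , c) → toSide (f′ , s′) ≡ inj₁ (e , not c) →
             Step (f , s , b) (f′ , s′ , b)

  step-sym : ∀ {x y} → Step x y → Step y x
  step-sym (around f x)              = subst (λ y → Step (f , turn x) (f , y)) (turn-involutive x) (around f (turn x))
  step-sym (across {c = false} b p q) = across b q p
  step-sym (across {c = true}  b p q) = across b q p

  across-flag : ∀ e c b → Step (flag (inj₁ (e , c)) b) (flag (inj₁ (e , not c)) b)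
  across-flag e c b = across b (to-from glue _) (to-from glue _)

module Rim {F E V : Set} (glue : (F × Fin 3) ↔ ((E × Bool) ⊎ Fin 3))
           (tail : E → Fin 3 ⊎ V) (head : E → V) where
  open Gluing glue

  endOf : (E × Bool) ⊎ Fin 3 → Bool → Fin 3 ⊎ V
  endOf (inj₁ (e , _)) false = tail e
  endOf (inj₁ (e , _)) true  = inj₂ (head e)
  endOf (inj₂ s)       b     = inj₁ (corner s b)

  anchorOf : (V → Flag) → Fin 3 ⊎ V → Flag
  anchorOf anchor (inj₁ 0F) = flag (inj₂ 0F) false
  anchorOf anchor (inj₁ 1F) = flag (inj₂ 0F) true
  anchorOf anchor (inj₁ 2F) = flag (inj₂ 1F) true
  anchorOf anchor (inj₂ w)  = anchor w

-- A triangle 012 with m tiles inserted; `Edge` and `Vertex` are those in its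
-- interior.  Every flag is joined to the anchor of its vertex by rotation
-- around that vertex.
record Patch (m : ℕ) : Set₁ where
  field
    Face Edge Vertex : Set
    Face↔   : Fin (m * 24 + 1) ↔ Face
    Edge↔   : Fin (m * 36 + 0) ↔ Edge
    Vertex↔ : Fin (m * 8 + 0) ↔ Vertex
    glue    : (Face × Fin 3) ↔ ((Edge × Bool) ⊎ Fin 3)
    vertex  : Face → Fin 3 → Fin 3 ⊎ Vertex
    tail    : Edge → Fin 3 ⊎ Vertex
    head    : Edge → Vertex
  open Gluing glue public
  open Rim glue tail head public
  field
    anchor   : Vertex → Flag
    ends     : ∀ f s b → endOf (toSide (f , s)) b ≡ vertex f (corner s b)
    fan      : ∀ f s b → Star Step (f , s , b) (anchorOf anchor (vertex f (corner s b)))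
    spoke    : ∀ w → ∃[ e ] tail e ≡ inj₁ 0F × head e ≡ w
    distinct : ∀ e e′ → tail e ≡ tail e′ → head e ≡ head e′ → e ≡ e′
    oriented : ∀ e e′ → tail e ≡ inj₂ (head e′) → tail e′ ≢ inj₂ (head e)
    clique   : Fin m → Fin 7 → Vertex
    cliques  : ∀ {j j′ s s′} → clique j s ≡ clique j′ s′ → j ≡ j′ × s ≡ s′
    chord    : ∀ j s t → s Fin.< t → ∃[ e ] tail e ≡ inj₂ (clique j s) × head e ≡ clique j t

module _ {m} (P : Patch m) where
  open Patch P

  -- Lets a rotation that enters a patch through its rim run on to the anchor of the corner.
  rim-fan : ∀ s b → Star Step (flag (inj₂ s) b) (anchorOf anchor (inj₁ (corner s b)))
  rim-fan s b = subst (Star Step (flag (inj₂ s) b) ∘ anchorOf anchor)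
    (trans (sym (ends _ _ b)) (cong (λ x → endOf x b) (to-from glue (inj₂ s))))
    (fan _ _ b)

triangle : Patch 0
triangle = record
  { Face = ⊤ ; Edge = ⊥ ; Vertex = ⊥
  ; Face↔ = 1↔⊤ ; Edge↔ = 0↔⊥ ; Vertex↔ = 0↔⊥
  ; glue = mk↔ₛ′ (λ (_ , s) → inj₂ s) (λ { (inj₂ s) → tt , s }) (λ { (inj₂ _) → refl }) (λ { (tt , _) → refl })
  ; vertex = λ _ → inj₁
  ; tail = λ () ; head = λ () ; anchor = λ ()
  ; ends = λ _ _ _ → refl
  ; fan = λ where
      _ 0F false → ε
      _ 0F true  → ε
      _ 1F false → around tt _ ◅ ε
      _ 1F true  → ε
      _ 2F false → around tt _ ◅ ε
      _ 2F true  → around tt _ ◅ ε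
  ; spoke = λ () ; distinct = λ () ; oriented = λ () ; clique = λ () ; cliques = λ { {()} } ; chord = λ ()
  }
  where open Gluing

module Insert {m} (P : Patch m) where
  private module P = Patch P

  Face Edge Vertex : Set
  Face   = Fin 24 ⊎ P.Face
  Edge   = (Fin 34 ⊎ Fin 2) ⊎ P.Edge
  Vertex = Fin 8 ⊎ P.Vertex

  -- The port sides of the tile and the sides 02 and 12 of `P` become the two sides of the port
  -- edges. The new rim consists of the side 01 of `P` and the outer sides of the tile.
  regroup : (Tile.Side ⊎ ((P.Edge × Bool) ⊎ Fin 3)) ↔ ((Edge × Bool) ⊎ Fin 3)
  regroup = mk↔ₛ′ to from
    (λ { (inj₁ (inj₁ (inj₁ _) , _)) → refl ; (inj₁ (inj₁ (inj₂ _) , false)) → refl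
       ; (inj₁ (inj₁ (inj₂ _) , true)) → refl
       ; (inj₁ (inj₂ _ , _)) → refl ; (inj₂ zero) → refl ; (inj₂ (suc _)) → refl })
    (λ { (inj₁ (Tile.inner _ _)) → refl ; (inj₁ (Tile.outer _)) → refl ; (inj₁ (Tile.port _)) → refl
       ; (inj₂ (inj₁ _)) → refl ; (inj₂ (inj₂ zero)) → refl ; (inj₂ (inj₂ (suc _))) → refl })
    where
    to : Tile.Side ⊎ ((P.Edge × Bool) ⊎ Fin 3) → (Edge × Bool) ⊎ Fin 3
    to (inj₁ (Tile.inner e c))  = inj₁ (inj₁ (inj₁ e) , c)
    to (inj₁ (Tile.outer q))    = inj₂ (suc q)
    to (inj₁ (Tile.port q))     = inj₁ (inj₁ (inj₂ q) , false)
    to (inj₂ (inj₁ (e , c)))    = inj₁ (inj₂ e , c)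
    to (inj₂ (inj₂ zero))       = inj₂ zero
    to (inj₂ (inj₂ (suc q)))    = inj₁ (inj₁ (inj₂ q) , true)
    from : (Edge × Bool) ⊎ Fin 3 → Tile.Side ⊎ ((P.Edge × Bool) ⊎ Fin 3)
    from (inj₁ (inj₁ (inj₁ e) , c))              = inj₁ (Tile.inner e c)
    from (inj₁ (inj₁ (inj₂ q) , false))   = inj₁ (Tile.port q)
    from (inj₁ (inj₁ (inj₂ q) , true))    = inj₂ (inj₂ (suc q))
    from (inj₁ (inj₂ e , c))       = inj₂ (inj₁ (e , c))
    from (inj₂ zero)                      = inj₂ (inj₂ zero)
    from (inj₂ (suc q))                   = inj₁ (Tile.outer q)

  glue : (Face × Fin 3) ↔ ((Edge × Bool) ⊎ Fin 3)
  glue = regroup ↔-∘ ((Tile.glue ⊎-↔ P.glue) ↔-∘ ×-distribʳ-⊎ 0ℓ (Fin 3) (Fin 24) P.Face)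

  open Gluing glue

  new : Fin 11 → Fin 3 ⊎ Vertex
  new u = Sum.map₂ inj₁ (splitAt 3 u)

  -- P is plugged into the triangle 013.
  old : Fin 3 ⊎ P.Vertex → Fin 3 ⊎ Vertex
  old (inj₁ 0F) = inj₁ 0F
  old (inj₁ 1F) = inj₁ 1F
  old (inj₁ 2F) = inj₂ (inj₁ 0F)
  old (inj₂ w)  = inj₂ (inj₂ w)

  vertex : Face → Fin 3 → Fin 3 ⊎ Vertex
  vertex (inj₁ t) c = new (Tile.vertex t c)
  vertex (inj₂ f) c = old (P.vertex f c)

  tail : Edge → Fin 3 ⊎ Vertex
  tail (inj₁ e) = new (Tile.tail e)
  tail (inj₂ e) = old (P.tail e)

  head : Edge → Vertex
  head (inj₁ e) = inj₁ (Tile.head e)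
  head (inj₂ e) = inj₂ (P.head e)

  open Rim glue tail head

  endOf-new : ∀ x b → endOf (Inverse.to regroup (inj₁ x)) b ≡ new (Tile.endOf x b)
  endOf-new (Tile.inner e _)  false = refl
  endOf-new (Tile.inner e _)  true  = refl
  endOf-new (Tile.outer 0F)   false = refl
  endOf-new (Tile.outer 0F)   true  = refl
  endOf-new (Tile.outer 1F)   false = refl
  endOf-new (Tile.outer 1F)   true  = refl
  endOf-new (Tile.port q)     false = refl
  endOf-new (Tile.port q)     true  = refl

  endOf-old : ∀ x b → endOf (Inverse.to regroup (inj₂ x)) b ≡ old (P.endOf x b)
  endOf-old (inj₁ (e , _)) false = refl
  endOf-old (inj₁ (e , _)) true  = refl
  endOf-old (inj₂ 0F)      false = refl
  endOf-old (inj₂ 0F)      true  = refl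
  endOf-old (inj₂ 1F)      false = refl
  endOf-old (inj₂ 1F)      true  = refl
  endOf-old (inj₂ 2F)      false = refl
  endOf-old (inj₂ 2F)      true  = refl

  ends : ∀ f s b → endOf (toSide (f , s)) b ≡ vertex f (corner s b)
  ends (inj₁ t) s b = trans (endOf-new (Tile.toSide (t , s)) b) (cong new (Tile.ends-ok t s b))
  ends (inj₂ f) s b = trans (endOf-old (P.toSide (f , s)) b) (cong old (P.ends f s b))

  ι : Tile.Flag → Flag
  ι (t , x) = inj₁ t , x

  κ : P.Flag → Flag
  κ (f , x) = inj₂ f , x

  ι-move : ∀ b x → Star Step (ι x) (ι (Tile.move b x))
  ι-move true  (t , x)     = around (inj₁ t) x ◅ ε
  ι-move false (t , s , b) with Tile.toSide (t , s) in eq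
  ... | Tile.outer _   = ε
  ... | Tile.port _    = ε
  ... | Tile.inner e c = across b (cong (Inverse.to regroup ∘ inj₁) eq)
                                  (cong (Inverse.to regroup ∘ inj₁) (Tile.to-from (Tile.inner e (not c)))) ◅ ε

  ι-fan : ∀ t s b → Star Step (ι (t , s , b)) (ι (Tile.anchor (Tile.vertex t (corner s b))))
  ι-fan t s b = Tile.reachesEither⇒Star ι ι-move 18 (t , s , b)
    (Tile.anchor (Tile.vertex t (corner s b))) (Tile.fan t s b)

  κ-step : ∀ {x y} → P.Step x y → Step (κ x) (κ y)
  κ-step (P.around f x)    = around (inj₂ f) x
  κ-step (P.across b p p′) = across b (cong (Inverse.to regroup ∘ inj₂) p) (cong (Inverse.to regroup ∘ inj₂) p′)

  inward : ∀ q b → Step (flag (inj₁ (inj₁ (inj₂ q) , false)) b) (flag (inj₁ (inj₁ (inj₂ q) , true)) b)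
  inward q b = across-flag (inj₁ (inj₂ q)) false b

  outward : ∀ q b → Step (flag (inj₁ (inj₁ (inj₂ q) , true)) b) (flag (inj₁ (inj₁ (inj₂ q) , false)) b)
  outward q b = across-flag (inj₁ (inj₂ q)) true b

  anchor : Vertex → Flag
  anchor (inj₁ w) = ι (Tile.anchor (3 ↑ʳ w))
  anchor (inj₂ w) = κ (P.anchor w)

  -- Rotation within the tile ends at an anchor of the tile, and at 0 or 1 goes on through the port
  -- into `P`. Rotation within `P` at its corner 2, the tile's vertex 3, comes out through the port.
  fan : ∀ f s b → Star Step (f , s , b) (anchorOf anchor (vertex f (corner s b)))
  fan (inj₁ t) s b = ι-fan t s b ◅◅ finish (Tile.vertex t (corner s b))
    where
    finish : ∀ u → Star Step (ι (Tile.anchor u)) (anchorOf anchor (new u))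
    finish 0F = inward 0F false ◅ gmap κ κ-step (rim-fan P 1F false)
    finish 1F = inward 1F false ◅ gmap κ κ-step (rim-fan P 2F false)
    finish 2F = ε
    finish (suc (suc (suc w))) = ε
  fan (inj₂ f) s b = gmap κ κ-step (P.fan f s b) ◅◅ finish (P.vertex f (corner s b))
    where
    finish : ∀ u → Star Step (κ (P.anchorOf P.anchor u)) (anchorOf anchor (old u))
    finish (inj₁ 0F) = ε
    finish (inj₁ 1F) = ε
    finish (inj₁ 2F) = outward 0F true ◅ ε
    finish (inj₂ w)  = ε

  new-injective : ∀ {u u′} → new u ≡ new u′ → u ≡ u′
  new-injective {u} {u′} eq = begin
    u                          ≡⟨ Fin.join-splitAt 3 8 u ⟨
    Fin.join 3 8 (splitAt 3 u)  ≡⟨ cong (Fin.join 3 8) (map₂-injective (splitAt 3 u) (splitAt 3 u′) eq) ⟩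
    Fin.join 3 8 (splitAt 3 u′) ≡⟨ Fin.join-splitAt 3 8 u′ ⟩
    u′                         ∎
    where
    open ≡-Reasoning
    map₂-injective : ∀ (x y : Fin 3 ⊎ Fin 8) → Sum.map₂ (inj₁ {B = P.Vertex}) x ≡ Sum.map₂ inj₁ y → x ≡ y
    map₂-injective (inj₁ _) (inj₁ _) refl = refl
    map₂-injective (inj₂ _) (inj₂ _) refl = refl

  new-≢ : ∀ u {w} → new u ≢ inj₂ (inj₂ w)
  new-≢ u eq with splitAt 3 u
  new-≢ u () | inj₁ _
  new-≢ u () | inj₂ _

  old-injective : ∀ {x y} → old x ≡ old y → x ≡ y
  old-injective {inj₁ 0F} {inj₁ 0F} _ = refl
  old-injective {inj₁ 1F} {inj₁ 1F} _ = refl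
  old-injective {inj₁ 2F} {inj₁ 2F} _ = refl
  old-injective {inj₂ _}  {inj₂ _}  refl = refl
  old-injective {inj₁ 0F} {inj₁ 1F} ()
  old-injective {inj₁ 0F} {inj₁ 2F} ()
  old-injective {inj₁ 1F} {inj₁ 2F} ()
  old-injective {inj₂ _}  {inj₁ 0F} ()
  old-injective {inj₂ _}  {inj₁ 1F} ()
  old-injective {inj₂ _}  {inj₁ 2F} ()

  spoke : ∀ w → ∃[ e ] tail e ≡ inj₁ 0F × head e ≡ w
  spoke (inj₁ w) = inj₁ (Tile.spoke w) , cong new (Tile.tail-spoke w) , cong inj₁ (Tile.head-spoke w)
  spoke (inj₂ w) = let e , t , h = P.spoke w in inj₂ e , cong old t , cong inj₂ h

  distinct : ∀ e e′ → tail e ≡ tail e′ → head e ≡ head e′ → e ≡ e′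
  distinct (inj₁ e) (inj₁ e′) t h = cong inj₁ (Tile.distinct e e′ (new-injective t) (Sum.inj₁-injective h))
  distinct (inj₂ e) (inj₂ e′) t h = cong inj₂ (P.distinct e e′ (old-injective t) (Sum.inj₂-injective h))

  oriented : ∀ e e′ → tail e ≡ inj₂ (head e′) → tail e′ ≢ inj₂ (head e)
  oriented (inj₁ e) (inj₁ e′) t t′ = Tile.oriented e e′ (new-injective t) (sym (new-injective t′))
  oriented (inj₁ e) (inj₂ e′) t _  = new-≢ (Tile.tail e) t
  oriented (inj₂ e) (inj₁ e′) _ t′ = new-≢ (Tile.tail e′) t′
  oriented (inj₂ e) (inj₂ e′) t t′ = P.oriented e e′ (old-injective t) (old-injective t′)

  clique : Fin (suc m) → Fin 7 → Vertex
  -- The shift by `suc` skips the tile's vertex 3, which is not part of its K₇.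
  clique zero    s = inj₁ (suc s)
  clique (suc j) s = inj₂ (P.clique j s)

  cliques : ∀ {j j′ s s′} → clique j s ≡ clique j′ s′ → j ≡ j′ × s ≡ s′
  cliques {zero}  {zero}  refl = refl , refl
  cliques {suc _} {suc _} eq   = map₁ (cong suc) (P.cliques (Sum.inj₂-injective eq))

  chord : ∀ j s t → s Fin.< t → ∃[ e ] tail e ≡ inj₂ (clique j s) × head e ≡ clique j t
  chord zero    s t s<t = let e , p , q = Tile.chord s t s<t in inj₁ (inj₁ e) , cong new p , cong inj₁ q
  chord (suc j) s t s<t = let e , p , q = P.chord j s t s<t in inj₂ e , cong old p , cong inj₂ q

insert : ∀ {m} → Patch m → Patch (suc m)
insert P = record
  { Face = Face ; Edge = Edge ; Vertex = Vertex
  ; Face↔ = (↔-id _ ⊎-↔ Patch.Face↔ P) ↔-∘ +↔⊎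
  ; Edge↔ = (+↔⊎ {34} {2} ⊎-↔ Patch.Edge↔ P) ↔-∘ +↔⊎ {36}
  ; Vertex↔ = (↔-id _ ⊎-↔ Patch.Vertex↔ P) ↔-∘ +↔⊎
  ; glue = glue ; vertex = vertex ; tail = tail ; head = head ; anchor = anchor
  ; ends = ends ; fan = fan ; spoke = spoke ; distinct = distinct ; oriented = oriented
  ; clique = clique ; cliques = cliques ; chord = chord
  }
  where open Insert P

patch : ∀ m → Patch m
patch zero    = triangle
patch (suc m) = insert (patch m)

-- Closed triangulations as maps and graphs

module Ends {E V : Set} (tail head : E → V) where

  endOf : (E × Bool) ⊎ ⊥ → Bool → V
  endOf (inj₁ (e , _)) false = tail e
  endOf (inj₁ (e , _)) true  = head e

  Link : V → V → Set
  Link u w = ∃[ e ] (tail e ≡ u × head e ≡ w ⊎ tail e ≡ w × head e ≡ u)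

-- A connected Δ-complex without boundary. By `fan` the flags at a vertex form a single rotation, so
-- that it is a surface; by `distinct` and `oriented` its graph is simple.
record Triangulation (#V #E #F : ℕ) : Set₁ where
  field
    Face Edge Vertex : Set
    Face↔   : Fin #F ↔ Face
    Edge↔   : Fin #E ↔ Edge
    Vertex↔ : Fin #V ↔ Vertex
    glue    : (Face × Fin 3) ↔ ((Edge × Bool) ⊎ ⊥)
    vertex  : Face → Fin 3 → Vertex
    tail    : Edge → Vertex
    head    : Edge → Vertex
  open Gluing glue public

  open Ends tail head public
  field
    anchor   : Vertex → Flag
    ends     : ∀ f s b → endOf (toSide (f , s)) b ≡ vertex f (corner s b)
    fan      : ∀ f s b → Star Step (f , s , b) (anchor (vertex f (corner s b)))
    incident : ∀ w → ∃[ e ] head e ≡ w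
    linked   : ∀ u w → Star Link u w
    distinct : ∀ e e′ → tail e ≡ tail e′ → head e ≡ head e′ → e ≡ e′
    oriented : ∀ e e′ → tail e ≡ head e′ → tail e′ ≢ head e

not-≢ : ∀ b → not b ≢ b
not-≢ true  ()
not-≢ false ()

turn-≢ : ∀ x → turn x ≢ x
turn-≢ (0F , false) ()
turn-≢ (0F , true)  ()
turn-≢ (1F , false) ()
turn-≢ (1F , true)  ()
turn-≢ (2F , false) ()
turn-≢ (2F , true)  ()

corner-turn : ∀ x → uncurry corner (turn x) ≡ uncurry corner x
corner-turn (0F , false) = refl
corner-turn (0F , true)  = refl
corner-turn (1F , false) = refl
corner-turn (1F , true)  = refl
corner-turn (2F , false) = refl
corner-turn (2F , true)  = refl

module Realise {#V #E #F} (T : Triangulation #V #E #F) where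
  open Triangulation T

  other : (Edge × Bool) ⊎ ⊥ → (Edge × Bool) ⊎ ⊥
  other (inj₁ (e , c)) = inj₁ (e , not c)

  other-involutive : ∀ x → other (other x) ≡ x
  other-involutive (inj₁ (e , c)) = cong (λ c → inj₁ (e , c)) (Bool.not-involutive c)

  other-≢ : ∀ x → other x ≢ x
  other-≢ (inj₁ (e , c)) eq = not-≢ c (cong proj₂ (Sum.inj₁-injective eq))

  τ : Fin 3 → Flag → Flag
  τ 0F (f , s , b) = f , s , not b
  τ 1F (f , x)     = f , turn x
  τ 2F (f , s , b) = flag (other (toSide (f , s))) b

  involutive : ∀ i x → τ i (τ i x) ≡ x
  involutive 0F (f , s , b) = cong (λ b → f , s , b) (Bool.not-involutive b)
  involutive 1F (f , x)     = cong (f ,_) (turn-involutive x)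
  involutive 2F (f , s , b) = cong (λ (f , s) → f , s , b) (begin
    fromSide (other (toSide (fromSide (other (toSide (f , s)))))) ≡⟨ cong (fromSide ∘ other) (to-from glue _) ⟩
    fromSide (other (other (toSide (f , s))))                     ≡⟨ cong fromSide (other-involutive _) ⟩
    fromSide (toSide (f , s))                                     ≡⟨ from-to glue _ ⟩
    f , s                                                         ∎)
    where open ≡-Reasoning

  fixedFree : ∀ i x → τ i x ≢ x
  fixedFree 0F (f , s , b) eq = not-≢ b (cong (proj₂ ∘ proj₂) eq)
  fixedFree 1F (f , x)     eq = turn-≢ x (cong proj₂ eq)
  fixedFree 2F (f , s , b) eq = other-≢ (toSide (f , s))
    (trans (sym (to-from glue _)) (cong (λ (f , s , _) → toSide (f , s)) eq))

  cellCount : Fin 3 → ℕ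
  cellCount 0F = #V
  cellCount 1F = #E
  cellCount 2F = #F

  Cell : Fin 3 → Set
  Cell 0F = Vertex
  Cell 1F = Edge
  Cell 2F = Face

  Cell↔ : ∀ i → Fin (cellCount i) ↔ Cell i
  Cell↔ 0F = Vertex↔
  Cell↔ 1F = Edge↔
  Cell↔ 2F = Face↔

  edgeOf : (Edge × Bool) ⊎ ⊥ → Edge
  edgeOf (inj₁ (e , _)) = e

  cell : ∀ i → Flag → Cell i
  cell 0F (f , s , b) = vertex f (corner s b)
  cell 1F (f , s , b) = edgeOf (toSide (f , s))
  cell 2F (f , s , b) = f

  edgeOf-other : ∀ x → edgeOf (other x) ≡ edgeOf x
  edgeOf-other (inj₁ _) = refl

  endOf-other : ∀ x b → endOf (other x) b ≡ endOf x b
  endOf-other (inj₁ _) false = refl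
  endOf-other (inj₁ _) true  = refl

  cell-flag : ∀ x b → cell 0F (flag x b) ≡ endOf x b
  cell-flag x b = trans (sym (ends _ _ b)) (cong (λ x → endOf x b) (to-from glue x))

  cell-τ : ∀ i j → j ≢ i → ∀ x → cell i (τ j x) ≡ cell i x
  cell-τ 0F 0F 0≢0 _ = contradiction refl 0≢0
  cell-τ 1F 1F 1≢1 _ = contradiction refl 1≢1
  cell-τ 2F 2F 2≢2 _ = contradiction refl 2≢2
  cell-τ 0F 1F _ (f , x)     = cong (vertex f) (corner-turn x)
  cell-τ 0F 2F _ (f , s , b) = trans (cell-flag (other (toSide (f , s))) b)
                                 (trans (endOf-other (toSide (f , s)) b) (ends f s b))
  cell-τ 1F 0F _ _           = refl
  cell-τ 1F 2F _ (f , s , b) = trans (cong edgeOf (to-from glue _)) (edgeOf-other (toSide (f , s)))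
  cell-τ 2F 0F _ _           = refl
  cell-τ 2F 1F _ _           = refl

  Near : Fin 3 → Flag → Flag → Set
  Near i u v = ∃[ j ] j ≢ i × τ j u ≡ v

  Adjacent : Flag → Flag → Set
  Adjacent u v = ∃[ j ] τ j u ≡ v

  near-sym : ∀ {i u v} → Near i u v → Near i v u
  near-sym (j , j≢i , refl) = j , j≢i , involutive j _

  near-star : ∀ {i u v} → Near i u v → Star (Near i) u v
  near-star n = n ◅ ε

  step⇒near : ∀ {u v} → Step u v → Near 0F u v
  step⇒near (around f x) = 1F , (λ ()) , refl
  step⇒near (across {f} {s} {f′} {s′} b p p′) = 2F , (λ ()) ,
    cong (λ (f , s) → f , s , b) (trans (cong (fromSide ∘ other) p) (trans (cong fromSide (sym p′)) (from-to glue _)))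

  toFirst : ∀ f s b → Star (Near 2F) (f , s , b) (f , 0F , false)
  toFirst f 0F false = ε
  toFirst f 0F true  = near-star (0F , (λ ()) , refl)
  toFirst f 1F false = near-star (1F , (λ ()) , refl)
  toFirst f 1F true  = (0F , (λ ()) , refl) ◅ near-star (1F , (λ ()) , refl)
  toFirst f 2F false = (1F , (λ ()) , refl) ◅ near-star (0F , (λ ()) , refl)
  toFirst f 2F true  = (1F , (λ ()) , refl) ◅ (0F , (λ ()) , refl) ◅ near-star (1F , (λ ()) , refl)

  toTail : ∀ f s b → Star (Near 1F) (f , s , b) (flag (inj₁ (edgeOf (toSide (f , s)) , false)) false)
  toTail f s true = (0F , (λ ()) , refl) ◅ toTail f s false
  toTail f s false with toSide (f , s) in eq
  ... | inj₁ (e , false) = subst (λ x → Star (Near 1F) (proj₁ x , proj₂ x , false) _)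
                             (trans (cong fromSide (sym eq)) (from-to glue _)) ε
  ... | inj₁ (e , true)  = near-star (2F , (λ ()) , cong (λ x → flag (other x) false) eq)

  -- Both flags are joined to a canonical flag of the cell: the anchor of a vertex, the tail end on
  -- the `false` side of an edge, the first corner of a face.
  sameCell⁺ : ∀ i u v → cell i u ≡ cell i v → Star (Near i) u v
  sameCell⁺ 0F u@(f , s , b) v@(f′ , s′ , b′) eq =
    gmap id step⇒near (subst (Star Step u ∘ anchor) eq (fan f s b)) ◅◅
    reverse near-sym (gmap id step⇒near (fan f′ s′ b′))
  sameCell⁺ 1F u@(f , s , b) v@(f′ , s′ , b′) eq =
    subst (λ e → Star (Near 1F) u (flag (inj₁ (e , false)) false)) eq (toTail f s b) ◅◅
    reverse near-sym (toTail f′ s′ b′)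
  sameCell⁺ 2F (f , s , b) (f , s′ , b′) refl = toFirst f s b ◅◅ reverse near-sym (toFirst f s′ b′)

  sameCell⁻ : ∀ i {u v} → Star (Near i) u v → cell i u ≡ cell i v
  sameCell⁻ i ε                      = refl
  sameCell⁻ i ((j , j≢i , refl) ◅ s) = trans (sym (cell-τ i j j≢i _)) (sameCell⁻ i s)

  near⇒adjacent : ∀ {i u v} → Near i u v → Adjacent u v
  near⇒adjacent (j , _ , eq) = j , eq

  -- For each link, rotate around the current vertex to a flag of the linking edge and pass to its
  -- other end by `τ 0F`.
  connected : ∀ {w} u v → cell 0F u ≡ w → Star Link w (cell 0F v) → Star Adjacent u v
  connected u v eq ε = gmap id near⇒adjacent (sameCell⁺ 0F u v eq)
  connected u v eq ((e , inj₁ (t , h)) ◅ s) =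
    gmap id near⇒adjacent (sameCell⁺ 0F u x (trans eq (sym (trans (cell-flag _ false) t)))) ◅◅
    (0F , refl) ◅ connected (τ 0F x) v (trans (cell-flag _ true) h) s
    where
    x : Flag
    x = flag (inj₁ (e , false)) false
  connected u v eq ((e , inj₂ (t , h)) ◅ s) =
    gmap id near⇒adjacent (sameCell⁺ 0F u x (trans eq (sym (trans (cell-flag _ true) h)))) ◅◅
    (0F , refl) ◅ connected (τ 0F x) v (trans (cell-flag _ false) t) s
    where
    x : Flag
    x = flag (inj₁ (e , false)) true

  cell-surjective : ∀ i w → ∃[ u ] cell i u ≡ w
  cell-surjective 0F w = let e , eq = incident w in flag (inj₁ (e , false)) true , trans (cell-flag _ true) eq
  cell-surjective 1F e = flag (inj₁ (e , false)) false , cong edgeOf (to-from glue _)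
  cell-surjective 2F f = (f , 0F , false) , refl

  Flag↔ : Fin (#F * (3 * 2)) ↔ Flag
  Flag↔ = (Face↔ ×-↔ ((↔-id _ ×-↔ 2↔Bool) ↔-∘ *↔×)) ↔-∘ *↔×

  open Inverse Flag↔ using () renaming (to to toFlag; from to fromFlag)

  toMap : Flag → Map
  toMap x₀ = record
    { flags      = #F * (3 * 2)
    ; nonEmpty   = inhabited (fromFlag x₀)
    ; τ          = λ i x → fromFlag (τ i (toFlag x))
    ; involutive = λ i x → trans (cong (fromFlag ∘ τ i) (to-from Flag↔ _))
                             (trans (cong fromFlag (involutive i _)) (from-to Flag↔ x))
    ; fixedFree  = λ i x eq → fixedFree i (toFlag x) (trans (sym (to-from Flag↔ _)) (cong toFlag eq))
    ; commute    = λ x → cong fromFlag (trans (cong (τ 0F) (to-from Flag↔ (τ 2F (toFlag x))))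
                                          (sym (cong (τ 2F) (to-from Flag↔ (τ 0F (toFlag x))))))
    -- `τ 0F` reverses the end recorded in the flag, while `τ 2F` preserves it.
    ; fourFlags  = λ x eq → not-≢ _ (cong (proj₂ ∘ proj₂) {τ 0F (toFlag x)} {τ 2F (toFlag x)}
                     (trans (sym (to-from Flag↔ (τ 0F (toFlag x))))
                       (trans (cong toFlag eq) (to-from Flag↔ (τ 2F (toFlag x))))))
    ; connected  = λ x y → subst₂ (Star _) (from-to Flag↔ x) (from-to Flag↔ y)
                     (gmap fromFlag (λ { (i , refl) → i , cong (fromFlag ∘ τ i) (to-from Flag↔ _) })
                       (connected (toFlag x) (toFlag y) refl (linked _ _)))
    ; cells      = cellCount
    ; cell       = λ i x → Inverse.from (Cell↔ i) (cell i (toFlag x))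
    ; surjective = λ i w → let u , eq = cell-surjective i (Inverse.to (Cell↔ i) w) in
                     fromFlag u , λ where
                       refl → trans (cong (Inverse.from (Cell↔ i)) (trans (cong (cell i) (to-from Flag↔ u)) eq))
                                (from-to (Cell↔ i) w)
    ; sameCell   = λ i x y → mk⇔
        (λ eq → subst₂ (Star _) (from-to Flag↔ x) (from-to Flag↔ y)
                  (gmap fromFlag (λ { (j , j≢i , refl) → j , j≢i , cong (fromFlag ∘ τ j) (to-from Flag↔ _) })
                    (sameCell⁺ i (toFlag x) (toFlag y) (Injection.injective (from↣ (Cell↔ i)) eq))))
        (λ s → cong (Inverse.from (Cell↔ i)) (sameCell⁻ i
                 (gmap toFlag (λ { (j , j≢i , refl) → j , j≢i , sym (to-from Flag↔ _) }) s)))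
    }
    where
    inhabited : ∀ {n} → Fin n → ℕ.NonZero n
    inhabited {suc n} _ = _
    from↣ : ∀ {A B : Set} → A ↔ B → B ↣ A
    from↣ i = ↔⇒↣ (↔-sym i)

  tailAt headAt : Fin #E → Fin #V
  tailAt = Inverse.from Vertex↔ ∘ tail ∘ Inverse.to Edge↔
  headAt = Inverse.from Vertex↔ ∘ head ∘ Inverse.to Edge↔

  Joins : Fin #E → Fin #V → Fin #V → Set
  Joins k u v = tailAt k ≡ u × headAt k ≡ v ⊎ tailAt k ≡ v × headAt k ≡ u

  Vertex-injective : ∀ {u w} → Inverse.from Vertex↔ u ≡ Inverse.from Vertex↔ w → u ≡ w
  Vertex-injective {u} {w} eq =
    trans (sym (to-from Vertex↔ u)) (trans (cong (Inverse.to Vertex↔) eq) (to-from Vertex↔ w))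

  toGraph : Graph
  toGraph = record
    { order       = #V
    ; Adj         = λ u v → ∃[ k ] Joins k u v
    ; adj?        = λ u v → any? λ k → (tailAt k ≟ u ×-dec headAt k ≟ v) ⊎-dec (tailAt k ≟ v ×-dec headAt k ≟ u)
    ; symmetric   = λ (k , joins) → k , Sum.swap joins
    ; irreflexive = λ where
        v (k , inj₁ th) → oriented _ _ (loopAt k th) (loopAt k th)
        v (k , inj₂ th) → oriented _ _ (loopAt k th) (loopAt k th)
    }
    where
    loopAt : ∀ k {v} → tailAt k ≡ v × headAt k ≡ v → tail (Inverse.to Edge↔ k) ≡ head (Inverse.to Edge↔ k)
    loopAt k (t , h) = Vertex-injective (trans t (sym h))

  link⇒adj : ∀ {u w} → Link u w → Graph.Adj toGraph (Inverse.from Vertex↔ u) (Inverse.from Vertex↔ w)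
  link⇒adj {u} {w} (e , joins) = 
    Inverse.from Edge↔ e , Sum.map (map (end tail) (end head)) (map (end tail) (end head)) joins
    where
    end : ∀ (h : Edge → Vertex) {x} → h e ≡ x →
          Inverse.from Vertex↔ (h (Inverse.to Edge↔ (Inverse.from Edge↔ e))) ≡ Inverse.from Vertex↔ x
    end h eq = cong (Inverse.from Vertex↔) (trans (cong h (to-from Edge↔ e)) eq)

  isSubgraph : ∀ x₀ → toGraph IsSubgraphOf toMap x₀
  isSubgraph x₀ = record
    { vertex    = id
    ; injective = id
    ; edge      = λ where
        u v (k , inj₁ (t , h)) → at k false , trans (at-vertex k false) t , trans (at-vertex′ k false) h
        u v (k , inj₂ (t , h)) → at k true , trans (at-vertex k true) h , trans (at-vertex′ k true) t
    }
    where
    edge : Fin #E → Edge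
    edge = Inverse.to Edge↔
    at : Fin #E → Bool → Fin (#F * (3 * 2))
    at k b = fromFlag (flag (inj₁ (edge k , false)) b)
    at-vertex : ∀ k b → Map.cell (toMap x₀) 0F (at k b) ≡ Inverse.from Vertex↔ (endOf (inj₁ (edge k , false)) b)
    at-vertex k b = cong (Inverse.from Vertex↔) (trans (cong (cell 0F) (to-from Flag↔ _)) (cell-flag _ b))
    at-vertex′ : ∀ k b → Map.cell (toMap x₀) 0F (Map.τ (toMap x₀) 0F (at k b)) ≡
                 Inverse.from Vertex↔ (endOf (inj₁ (edge k , false)) (not b))
    at-vertex′ k b = cong (Inverse.from Vertex↔) (trans (cong (cell 0F)
      (trans (to-from Flag↔ _) (cong (τ 0F) (to-from Flag↔ _)))) (cell-flag _ (not b)))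

  distinctAt : ∀ {k l} → tailAt k ≡ tailAt l → headAt k ≡ headAt l → k ≡ l
  distinctAt {k} {l} t h = trans (sym (from-to Edge↔ k))
    (trans (cong (Inverse.from Edge↔) (distinct _ _ (Vertex-injective t) (Vertex-injective h))) (from-to Edge↔ l))

  orientedAt : ∀ k l → tailAt k ≡ headAt l → headAt k ≢ tailAt l
  orientedAt k l t h = oriented _ _ (Vertex-injective t) (sym (Vertex-injective h))

  walk : List (Fin 3) → Flag → Flag
  walk is x = List.foldl (flip τ) x is

  -- An orientation changes value at every step, which a closed walk of odd length forbids. The fold
  -- computes the parity of the length.
  nonOrientable : ∀ x₀ x is → walk is x ≡ x → List.foldr (λ _ → not) false is ≡ true → ¬ Map.Orientable (toMap x₀)
  nonOrientable x₀ x is closed odd (o , alternates) = contradiction (begin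
    o (fromFlag x)              ≡⟨ cong (o ∘ fromFlag) closed ⟨
    o (fromFlag (walk is x))    ≡⟨ along is x ⟩
    List.foldr (λ _ → not) false is xor o (fromFlag x) ≡⟨ cong (_xor o (fromFlag x)) odd ⟩
    not (o (fromFlag x))        ∎) (not-≢ _ ∘ sym)
    where
    open ≡-Reasoning
    along : ∀ is x → o (fromFlag (walk is x)) ≡ List.foldr (λ _ → not) false is xor o (fromFlag x)
    along []       x = refl
    along (i ∷ is) x = begin
      o (fromFlag (walk is (τ i x)))          ≡⟨ along is (τ i x) ⟩
      p xor o (fromFlag (τ i x))              ≡⟨ cong (λ y → p xor o (fromFlag (τ i y))) (to-from Flag↔ x) ⟨
      p xor o (fromFlag (τ i (toFlag (fromFlag x)))) ≡⟨ cong (p xor_) (alternates i (fromFlag x)) ⟩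
      p xor not (o (fromFlag x))              ≡⟨ Bool.not-distribʳ-xor p _ ⟨
      not (p xor o (fromFlag x))              ≡⟨ Bool.not-distribˡ-xor p _ ⟩
      not p xor o (fromFlag x)                ∎
      where
      p : Bool
      p = List.foldr (λ _ → not) false is

-- Closing up: patches in the up triangles of the torus

-- K₇ on the torus, with vertices ℤ/7 and the triangles up i = {i, i+1, i+3} and
-- down l = {l, l+2, l+3}.  An edge is named by the up triangle i and its side.
module Torus where

  infixl 6 _⊞_
  _⊞_ : Fin 7 → ℕ → Fin 7
  i ⊞ n = (toℕ i + n) mod 7

  up down : Fin 7 → Fin 3 → Fin 7
  up i 0F = i
  up i 1F = i ⊞ 1
  up i 2F = i ⊞ 3
  down i 0F = i
  down i 1F = i ⊞ 2
  down i 2F = i ⊞ 3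

  -- Sides 0, 1, 2 of a down triangle have differences 2, 3, 1, as do sides 2, 1, 0 of an up
  -- triangle. Adding 6 subtracts 1 modulo 7.
  across : Fin 7 × Fin 3 → Fin 7 × Fin 3
  across (l , 0F) = l ⊞ 6 , 2F
  across (l , 1F) = l , 1F
  across (l , 2F) = l ⊞ 2 , 0F

  back : Fin 7 × Fin 3 → Fin 7 × Fin 3
  back (i , 0F) = i ⊞ 5 , 2F
  back (i , 1F) = i , 1F
  back (i , 2F) = i ⊞ 1 , 0F

  Node : Set
  Node = (Bool × Fin 7) × Fin 3 × Bool

  τ₁ τ₂ : Node → Node
  τ₁ (f , x) = f , turn x
  τ₂ ((false , l) , s , b) = let (i , s′) = across (l , s) in (true , i) , s′ , b
  τ₂ ((true , i) , s , b)  = let (l , s′) = back (i , s) in (false , l) , s′ , b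

  hub : Node → Fin 7
  hub ((false , l) , s , b) = down l (corner s b)
  hub ((true , i) , s , b)  = up i (corner s b)

  anchor : Fin 7 → Node
  anchor h = (false , h) , 1F , false

  open Walk {Node} (≡-dec (≡-dec Bool._≟_ _≟_) (≡-dec _≟_ Bool._≟_)) τ₁ τ₂ public

  abstract
    -- Six triangles meet at each vertex, giving twelve flags, so 12 moves go all the way around.
    fan : ∀ k i s b → let x = (k , i) , s , b in
          reaches 12 true x (anchor (hub x)) ∨ reaches 12 false x (anchor (hub x)) ≡ true
    fan = from-yes (all-Bool? λ k → all? λ i → all? λ s → all-Bool? λ b → let x = (k , i) , s , b in
      (reaches 12 true x (anchor (hub x)) ∨ reaches 12 false x (anchor (hub x))) Bool.≟ true)

    across-back : ∀ x → across (back x) ≡ x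
    across-back (i , s) = from-yes (all? λ i → all? λ s → ≡-dec _≟_ _≟_ (across (back (i , s))) (i , s)) i s

    back-across : ∀ x → back (across x) ≡ x
    back-across (i , s) = from-yes (all? λ i → all? λ s → ≡-dec _≟_ _≟_ (back (across (i , s))) (i , s)) i s

    ends : ∀ l s b → (let (i , s′) = across (l , s) in up i (corner s′ b)) ≡ down l (corner s b)
    ends = from-yes (all? λ l → all? λ s → all-Bool? λ b →
      (let (i , s′) = across (l , s) in up i (corner s′ b)) ≟ down l (corner s b))

    predecessor : ∀ h → (h ⊞ 6) ⊞ 1 ≡ h
    predecessor = from-yes (all? λ h → ((h ⊞ 6) ⊞ 1) ≟ h)

    up-injective : ∀ i c c′ → up i c ≡ up i c′ → c ≡ c′
    up-injective = from-yes (all? λ i → all? λ c → all? λ c′ → (up i c ≟ up i c′) →-dec (c ≟ c′))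

    distinct : ∀ i s i′ s′ → up i (corner s false) ≡ up i′ (corner s′ false) →
               up i (corner s true) ≡ up i′ (corner s′ true) → (i , s) ≡ (i′ , s′)
    distinct = from-yes (all? λ i → all? λ s → all? λ i′ → all? λ s′ →
      (up i (corner s false) ≟ up i′ (corner s′ false)) →-dec
      (up i (corner s true) ≟ up i′ (corner s′ true)) →-dec ≡-dec _≟_ _≟_ (i , s) (i′ , s′))

    oriented : ∀ i s i′ s′ → up i (corner s false) ≡ up i′ (corner s′ true) →
               up i′ (corner s′ false) ≢ up i (corner s true)
    oriented = from-yes (all? λ i → all? λ s → all? λ i′ → all? λ s′ →
      (up i (corner s false) ≟ up i′ (corner s′ true)) →-dec
      ¬? (up i′ (corner s′ false) ≟ up i (corner s true)))

    chord : ∀ h h′ → h ≢ h′ → ∃[ i ] ∃[ s ]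
            (up i (corner s false) ≡ h × up i (corner s true) ≡ h′ ⊎
             up i (corner s false) ≡ h′ × up i (corner s true) ≡ h)
    chord = from-yes (all? λ h → all? λ h′ → ¬? (h ≟ h′) →-dec any? λ i → any? λ s →
      (up i (corner s false) ≟ h ×-dec up i (corner s true) ≟ h′) ⊎-dec
      (up i (corner s false) ≟ h′ ×-dec up i (corner s true) ≟ h))

  glue : (Fin 7 × Fin 3) ↔ (Fin 7 × Fin 3)
  glue = mk↔ₛ′ across back across-back back-across

module CloseUp {m} (P : Patch m) where
  private module P = Patch P

  -- The down triangles remain and each up triangle becomes a copy of `P`. Corner 0 of copy `i` is
  -- the hub `i`, so that every hub has its own tiles.
  Face Edge Vertex : Set
  Face   = Fin 7 ⊎ (Fin 7 × P.Face)
  Edge   = Fin 7 × (Fin 3 ⊎ P.Edge)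
  Vertex = Fin 7 ⊎ (Fin 7 × P.Vertex)

  split : (Face × Fin 3) ↔ ((Fin 7 × Fin 3) ⊎ (Fin 7 × (P.Face × Fin 3)))
  split = mk↔ₛ′
    (λ { (inj₁ l , s) → inj₁ (l , s) ; (inj₂ (i , f) , s) → inj₂ (i , f , s) })
    (λ { (inj₁ (l , s)) → inj₁ l , s ; (inj₂ (i , f , s)) → inj₂ (i , f) , s })
    (λ { (inj₁ _) → refl ; (inj₂ _) → refl })
    (λ { (inj₁ _ , _) → refl ; (inj₂ _ , _) → refl })

  regroup : ((Fin 7 × Fin 3) ⊎ (Fin 7 × ((P.Edge × Bool) ⊎ Fin 3))) ↔ ((Edge × Bool) ⊎ ⊥)
  regroup = mk↔ₛ′ to from
    (λ { (inj₁ ((_ , inj₁ _) , false)) → refl ; (inj₁ ((_ , inj₁ _) , true)) → refl ; (inj₁ ((_ , inj₂ _) , _)) → refl })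
    (λ { (inj₁ _) → refl ; (inj₂ (_ , inj₁ _)) → refl ; (inj₂ (_ , inj₂ _)) → refl })
    where
    to : (Fin 7 × Fin 3) ⊎ (Fin 7 × ((P.Edge × Bool) ⊎ Fin 3)) → (Edge × Bool) ⊎ ⊥
    to (inj₁ (i , s))             = inj₁ ((i , inj₁ s) , false)
    to (inj₂ (i , inj₁ (e , c)))  = inj₁ ((i , inj₂ e) , c)
    to (inj₂ (i , inj₂ s))        = inj₁ ((i , inj₁ s) , true)
    from : (Edge × Bool) ⊎ ⊥ → (Fin 7 × Fin 3) ⊎ (Fin 7 × ((P.Edge × Bool) ⊎ Fin 3))
    from (inj₁ ((i , inj₁ s) , false)) = inj₁ (i , s)
    from (inj₁ ((i , inj₁ s) , true))  = inj₂ (i , inj₂ s)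
    from (inj₁ ((i , inj₂ e) , c))     = inj₂ (i , inj₁ (e , c))

  glue : (Face × Fin 3) ↔ ((Edge × Bool) ⊎ ⊥)
  glue = regroup ↔-∘ ((Torus.glue ⊎-↔ (↔-id _ ×-↔ P.glue)) ↔-∘ split)

  open Gluing glue

  place : Fin 7 → Fin 3 ⊎ P.Vertex → Vertex
  place i (inj₁ c) = inj₁ (Torus.up i c)
  place i (inj₂ w) = inj₂ (i , w)

  vertex : Face → Fin 3 → Vertex
  vertex (inj₁ l)       c = inj₁ (Torus.down l c)
  vertex (inj₂ (i , f)) c = place i (P.vertex f c)

  tail head : Edge → Vertex
  tail (i , inj₁ s) = inj₁ (Torus.up i (corner s false))
  tail (i , inj₂ e) = place i (P.tail e)
  head (i , inj₁ s) = inj₁ (Torus.up i (corner s true))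
  head (i , inj₂ e) = inj₂ (i , P.head e)

  open Ends tail head

  endOf-across : ∀ x b → endOf (Inverse.to regroup (inj₁ x)) b ≡ inj₁ (Torus.up (proj₁ x) (corner (proj₂ x) b))
  endOf-across x false = refl
  endOf-across x true  = refl

  endOf-place : ∀ i x b → endOf (Inverse.to regroup (inj₂ (i , x))) b ≡ place i (P.endOf x b)
  endOf-place i (inj₁ _) false = refl
  endOf-place i (inj₁ _) true  = refl
  endOf-place i (inj₂ _) false = refl
  endOf-place i (inj₂ _) true  = refl

  ends : ∀ f s b → endOf (toSide (f , s)) b ≡ vertex f (corner s b)
  ends (inj₁ l)       s b = trans (endOf-across (Torus.across (l , s)) b) (cong inj₁ (Torus.ends l s b))
  ends (inj₂ (i , f)) s b = trans (endOf-place i (P.toSide (f , s)) b) (cong (place i) (P.ends f s b))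

  κ : Fin 7 → P.Flag → Flag
  κ i (f , x) = inj₂ (i , f) , x

  κ-step : ∀ i {x y} → P.Step x y → Step (κ i x) (κ i y)
  κ-step i (P.around f x)    = around (inj₂ (i , f)) x
  κ-step i (P.across b p p′) = across b (cong (λ x → Inverse.to regroup (inj₂ (i , x))) p)
                                        (cong (λ x → Inverse.to regroup (inj₂ (i , x))) p′)

  κ-star : ∀ i {x y} → Star P.Step x y → Star Step (κ i x) (κ i y)
  κ-star i = gmap (κ i) (κ-step i)

  -- A flag of an up triangle, no longer a face, is represented by the flag of the patch on the same
  -- rim side.
  ι : Torus.Node → Flag
  ι ((false , l) , x)     = inj₁ l , x
  ι ((true , i) , s , b)  = κ i (P.flag (inj₂ s) b)

  ι-rim : ∀ i s b → Step (κ i (P.flag (inj₂ s) b)) (ι (Torus.τ₂ ((true , i) , s , b)))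
  ι-rim i s b = across b
    (cong (λ x → Inverse.to regroup (inj₂ (i , x))) (to-from P.glue (inj₂ s)))
    (cong (Inverse.to regroup ∘ inj₁) (Torus.across-back (i , s)))

  -- Turning at a corner of an up triangle is replaced by rotating through the patch, by way of the
  -- anchor of that corner.
  ι-move : ∀ b x → Star Step (ι x) (ι (Torus.move b x))
  ι-move true  ((false , l) , x)     = around (inj₁ l) x ◅ ε
  ι-move true  ((true , i) , s , b)  = κ-star i (rim-fan P s b ◅◅
    subst (λ c → Star P.Step (P.anchorOf P.anchor (inj₁ c)) (uncurry (P.flag ∘ inj₂) (turn (s , b))))
      (corner-turn (s , b))
      (reverse P.step-sym (uncurry (rim-fan P) (turn (s , b)))))
  ι-move false ((false , l) , s , b) = across b refl
    (cong (λ x → Inverse.to regroup (inj₂ (proj₁ (Torus.across (l , s)) , x))) (to-from P.glue (inj₂ _))) ◅ ε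
  ι-move false ((true , i) , s , b)  = ι-rim i s b ◅ ε

  ι-fan : ∀ k i s b → let x = (k , i) , s , b in Star Step (ι x) (ι (Torus.anchor (Torus.hub x)))
  ι-fan k i s b = Torus.reachesEither⇒Star ι ι-move 12 x (Torus.anchor (Torus.hub x)) (Torus.fan k i s b)
    where
    x : Torus.Node
    x = (k , i) , s , b

  anchor : Vertex → Flag
  anchor (inj₁ h)       = ι (Torus.anchor h)
  anchor (inj₂ (i , w)) = κ i (P.anchor w)

  fan : ∀ f s b → Star Step (f , s , b) (anchor (vertex f (corner s b)))
  fan (inj₁ l)       s b = ι-fan false l s b
  fan (inj₂ (i , f)) s b = κ-star i (P.fan f s b) ◅◅ finish (P.vertex f (corner s b))
    where
    finish : ∀ u → Star Step (κ i (P.anchorOf P.anchor u)) (anchor (place i u))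
    finish (inj₁ 0F) = ι-fan true i 0F false
    finish (inj₁ 1F) = ι-fan true i 0F true
    finish (inj₁ 2F) = ι-fan true i 1F true
    finish (inj₂ w)  = ε

  incident : ∀ w → ∃[ e ] head e ≡ w
  incident (inj₁ h)       = (h Torus.⊞ 6 , inj₁ 0F) , cong inj₁ (Torus.predecessor h)
  incident (inj₂ (i , w)) = let e , _ , eq = P.spoke w in (i , inj₂ e) , cong (λ w → inj₂ (i , w)) eq

  link-sym : ∀ {u w} → Link u w → Link w u
  link-sym (e , ends) = e , Sum.swap ends

  spoke : ∀ i w → Link (inj₁ i) (inj₂ (i , w))
  spoke i w = let e , t , h = P.spoke w in (i , inj₂ e) , inj₁ (cong (place i) t , cong (λ w → inj₂ (i , w)) h)

  hubs-linked : ∀ {h h′} → h ≢ h′ → Link (inj₁ h) (inj₁ h′)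
  hubs-linked {h} {h′} h≢h′ = let i , s , ends = Torus.chord h h′ h≢h′ in
    (i , inj₁ s) , Sum.map (map (cong inj₁) (cong inj₁)) (map (cong inj₁) (cong inj₁)) ends

  to-hub : ∀ u → ∃[ h ] Star Link u (inj₁ h)
  to-hub (inj₁ h)       = h , ε
  to-hub (inj₂ (i , w)) = i , link-sym (spoke i w) ◅ ε

  linked : ∀ u w → Star Link u w
  linked u w with to-hub u | to-hub w
  ... | h , u⇒h | h′ , w⇒h′ = u⇒h ◅◅ between (h ≟ h′) ◅◅ reverse link-sym w⇒h′
    where
    between : Dec (h ≡ h′) → Star Link (inj₁ h) (inj₁ h′)
    between (yes refl) = ε
    between (no h≢h′)  = hubs-linked h≢h′ ◅ ε

  place-injective : ∀ {i x y} → place i x ≡ place i y → x ≡ y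
  place-injective {i} {inj₁ c} {inj₁ c′} eq   = cong inj₁ (Torus.up-injective i c c′ (Sum.inj₁-injective eq))
  place-injective {i} {inj₂ _} {inj₂ _}  refl = refl

  place-interior : ∀ {i x j w} → place i x ≡ inj₂ (j , w) → i ≡ j × x ≡ inj₂ w
  place-interior {x = inj₂ _} refl = refl , refl

  distinct : ∀ e e′ → tail e ≡ tail e′ → head e ≡ head e′ → e ≡ e′
  distinct (i , inj₁ s) (i′ , inj₁ s′) t h =
    cong (λ (i , s) → i , inj₁ s) (Torus.distinct i s i′ s′ (Sum.inj₁-injective t) (Sum.inj₁-injective h))
  distinct (i , inj₂ e) (i′ , inj₂ e′) t h with ,-injective (Sum.inj₂-injective h)
  ... | refl , h′ = cong (λ e → i , inj₂ e) (P.distinct e e′ (place-injective t) h′)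

  oriented : ∀ e e′ → tail e ≡ head e′ → tail e′ ≢ head e
  oriented (i , inj₁ s) (i′ , inj₁ s′) t t′ =
    Torus.oriented i s i′ s′ (Sum.inj₁-injective t) (Sum.inj₁-injective t′)
  oriented (i , inj₂ e) (i′ , inj₂ e′) t t′ =
    P.oriented e e′ (proj₂ (place-interior t)) (proj₂ (place-interior t′))

  chord : ∀ i j {s t} → s ≢ t → Link (inj₂ (i , P.clique j s)) (inj₂ (i , P.clique j t))
  chord i j {s} {t} s≢t with Fin.<-cmp s t
  ... | tri< s<t _ _ = let e , p , q = P.chord j s t s<t in
    (i , inj₂ e) , inj₁ (cong (place i) p , cong (λ w → inj₂ (i , w)) q)
  ... | tri≈ _ s≡t _ = contradiction s≡t s≢t
  ... | tri> _ _ t<s = let e , p , q = P.chord j t s t<s in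
    (i , inj₂ e) , inj₂ (cong (place i) p , cong (λ w → inj₂ (i , w)) q)

  triangulation : Triangulation (7 + 7 * (m * 8 + 0)) (7 * (3 + (m * 36 + 0))) (7 + 7 * (m * 24 + 1))
  triangulation = record
    { Face = Face ; Edge = Edge ; Vertex = Vertex
    ; Face↔ = (↔-id _ ⊎-↔ ((↔-id _ ×-↔ P.Face↔) ↔-∘ *↔×)) ↔-∘ +↔⊎
    ; Edge↔ = (↔-id _ ×-↔ ((↔-id _ ⊎-↔ P.Edge↔) ↔-∘ +↔⊎)) ↔-∘ *↔×
    ; Vertex↔ = (↔-id _ ⊎-↔ ((↔-id _ ×-↔ P.Vertex↔) ↔-∘ *↔×)) ↔-∘ +↔⊎
    ; glue = glue ; vertex = vertex ; tail = tail ; head = head ; anchor = anchor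
    ; ends = ends ; fan = fan ; incident = incident ; linked = linked
    ; distinct = distinct ; oriented = oriented
    }

-- The example

all-Vec? : ∀ n {P : Vec Bool n → Set} → (∀ v → Dec (P v)) → Dec (∀ v → P v)
all-Vec? zero    P? = map′ (λ p → λ { [] → p }) (λ p → p []) (P? [])
all-Vec? (suc n) P? = map′ (λ { (p , q) (true ∷ v) → p v ; (p , q) (false ∷ v) → q v })
                           (λ p → (λ v → p (true ∷ v)) , (λ v → p (false ∷ v)))
                           (all-Vec? n (λ v → P? (true ∷ v)) ×-dec all-Vec? n (λ v → P? (false ∷ v)))

abstract
  -- The pigeonhole principle, checked on all 128 vectors. The strict descent from `d` to `e` makes
  -- the four positions distinct.
  four-alike : ∀ (v : Vec Bool 7) → ∃[ d ]
    ∃[ a ] (a Fin.< d × lookup v a ≡ lookup v d ×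
      (∃[ b ] (b Fin.< a × lookup v b ≡ lookup v d ×
        (∃[ e ] (e Fin.< b × lookup v e ≡ lookup v d)))))
  four-alike = from-yes (all-Vec? 7 λ v → any? λ d → 
    any? λ a → (a Fin.<? d) ×-dec (lookup v a Bool.≟ lookup v d) ×-dec
      any? λ b → (b Fin.<? a) ×-dec (lookup v b Bool.≟ lookup v d) ×-dec
        any? λ e → (e Fin.<? b) ×-dec (lookup v e Bool.≟ lookup v d))

module _ (G : Graph) where
  open Graph G

  likeNeighbours-≥ : ∀ {k} (c : Fin order → Fin k) v {n} (f : Fin n → Fin order) → Injective _≡_ _≡_ f →
                     (∀ i → Adj v (f i)) → (∀ i → c (f i) ≡ c v) → n ≤ likeNeighbours G c v
  likeNeighbours-≥ c v f f-inj adj same =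
    length-filter-≥ (λ w → adj? v w ×-dec (c w ≟ c v)) f f-inj λ i → adj i , same i

  third-colour : ∀ {d} {c : Fin order → Fin 3} → IsColoring G (+ 2 ∷ + 2 ∷ d ∷ []) c →
                 (f : Fin 7 → Fin order) → (∀ {s t} → s ≢ t → Adj (f s) (f t)) → ∃[ s ] c (f s) ≡ 2F
  third-colour {d} {c} ok f adj with any? (λ s → c (f s) ≟ 2F)
  ... | yes found = found
  -- The third color being absent, `true` stands for the first color and `false` for the second.
  ... | no  none  with four-alike (Vec.tabulate λ s → does (c (f s) ≟ 0F))
  ...   | v , a , a<v , ca , b , b<a , cb , e , e<b , ce = contradiction
    (likeNeighbours-≥ c (f v) (f ∘ pick) (λ {i} {j} eq → pick-injective i j (f-injective eq))
      (λ i → adj (pick-≢ i ∘ sym))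
      (λ i → alike _ _ (none ∘ (pick i ,_)) (none ∘ (v ,_)) (pick-alike i)))
    (few (c (f v)) (none ∘ (v ,_)) (ok (f v)))
    where
    f-injective : ∀ {s t} → f s ≡ f t → s ≡ t
    f-injective {s} {t} eq with s ≟ t
    ... | yes s≡t = s≡t
    ... | no  s≢t = contradiction (subst (Adj (f s)) (sym eq) (adj s≢t)) (irreflexive _)
    pick : Fin 3 → Fin 7
    pick 0F = a
    pick 1F = b
    pick 2F = e
    b<v : b Fin.< v
    b<v = ℕ.<-trans b<a a<v
    e<a : e Fin.< a
    e<a = ℕ.<-trans e<b b<a
    pick-≢ : ∀ i → pick i ≢ v
    pick-≢ 0F = Fin.<⇒≢ a<v
    pick-≢ 1F = Fin.<⇒≢ b<v
    pick-≢ 2F = Fin.<⇒≢ (ℕ.<-trans e<b b<v)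
    pick-injective : ∀ i j → pick i ≡ pick j → i ≡ j
    pick-injective 0F 0F _ = refl
    pick-injective 1F 1F _ = refl
    pick-injective 2F 2F _ = refl
    pick-injective 0F 1F eq = contradiction (sym eq) (Fin.<⇒≢ b<a)
    pick-injective 1F 0F eq = contradiction eq (Fin.<⇒≢ b<a)
    pick-injective 0F 2F eq = contradiction (sym eq) (Fin.<⇒≢ e<a)
    pick-injective 2F 0F eq = contradiction eq (Fin.<⇒≢ e<a)
    pick-injective 1F 2F eq = contradiction (sym eq) (Fin.<⇒≢ e<b)
    pick-injective 2F 1F eq = contradiction eq (Fin.<⇒≢ e<b)
    colour : Fin 7 → Bool
    colour s = does (c (f s) ≟ 0F)
    untab : ∀ {s} → lookup (Vec.tabulate colour) s ≡ lookup (Vec.tabulate colour) v → colour s ≡ colour v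
    untab eq = trans (sym (Vec.lookup∘tabulate colour _)) (trans eq (Vec.lookup∘tabulate colour v))
    pick-alike : ∀ i → colour (pick i) ≡ colour v
    pick-alike 0F = untab ca
    pick-alike 1F = untab cb
    pick-alike 2F = untab ce
    alike : ∀ (x y : Fin 3) → x ≢ 2F → y ≢ 2F → does (x ≟ 0F) ≡ does (y ≟ 0F) → x ≡ y
    alike 0F 0F _ _ _ = refl
    alike 1F 1F _ _ _ = refl
    alike 2F _ x≢2 _ _ = contradiction refl x≢2
    alike _ 2F _ y≢2 _ = contradiction refl y≢2
    few : ∀ (x : Fin 3) → x ≢ 2F → ∀ {n} → + n ℤ.≤ lookup (+ 2 ∷ + 2 ∷ d ∷ []) x → ¬ (3 ≤ n)
    few 0F _ (ℤ.+≤+ n≤2) 3≤n = ℕ.<-irrefl refl (ℕ.≤-trans 3≤n n≤2)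
    few 1F _ (ℤ.+≤+ n≤2) 3≤n = ℕ.<-irrefl refl (ℕ.≤-trans 3≤n n≤2)
    few 2F x≢2 _ _ = contradiction refl x≢2

-- Arithmetic of the Euler characteristic and of the ceiling

euler⁺ : ∀ v e f g → v + f + g ≡ 2 + e → + v ℤ.- + e ℤ.+ + f ≡ + 2 ℤ.- + g
euler⁺ v e f g eq = begin
  + v ℤ.- + e ℤ.+ + f
    ≡⟨ solve 4 (λ v e f g → v :- e :+ f := v :+ f :+ g :+ (:- e :- g)) refl (+ v) (+ e) (+ f) (+ g) ⟩
  + (v + f + g) ℤ.+ (ℤ.- + e ℤ.- + g)               ≡⟨ cong (λ s → + s ℤ.+ (ℤ.- + e ℤ.- + g)) eq ⟩
  + 2 ℤ.+ + e ℤ.+ (ℤ.- + e ℤ.- + g)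
    ≡⟨ solve 2 (λ e g → con (+ 2) :+ e :+ (:- e :- g) := con (+ 2) :- g) refl (+ e) (+ g) ⟩
  + 2 ℤ.- + g                                       ∎
  where
  open ≡-Reasoning
  open ℤ-Solver

euler⁻ : ∀ v e f g → + v ℤ.- + e ℤ.+ + f ≡ + 2 ℤ.- + g → v + f + g ≡ 2 + e
euler⁻ v e f g eq = ℤ.+-injective (begin
  + (v + f + g)
    ≡⟨ solve 4 (λ v e f g → v :+ f :+ g := v :- e :+ f :+ (e :+ g)) refl (+ v) (+ e) (+ f) (+ g) ⟩
  + v ℤ.- + e ℤ.+ + f ℤ.+ (+ e ℤ.+ + g)             ≡⟨ cong (ℤ._+ (+ e ℤ.+ + g)) eq ⟩
  + 2 ℤ.- + g ℤ.+ (+ e ℤ.+ + g)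
    ≡⟨ solve 2 (λ e g → con (+ 2) :- g :+ (e :+ g) := con (+ 2) :+ e) refl (+ e) (+ g) ⟩
  + (2 + e)                                         ∎)
  where
  open ≡-Reasoning
  open ℤ-Solver

isMapOn⇒χ : ∀ {M} S → M IsMapOn S → Map.χ M ≡ + 2 ℤ.- + eulerGenus S
isMapOn⇒χ (sphereWithHandles h)   = proj₂
isMapOn⇒χ (sphereWithCrossCaps k) = proj₂

-- Division of a negative integer is defined by cases on the remainder, which vanishes here; zero is
-- treated apart, as its negation is nonnegative.
-[n*d]/d : ∀ n d .{{_ : ℕ.NonZero d}} → (ℤ.- + (n * d)) ℤ./ℕ d ≡ ℤ.- + n
-[n*d]/d n d = lemma (n * d) (ℕ.m*n%n≡0 n d) (ℕ.m*n/n≡m n d)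
  where
  lemma : ∀ x → x ℕ.% d ≡ 0 → x ℕ./ d ≡ n → (ℤ.- + x) ℤ./ℕ d ≡ ℤ.- + n
  lemma zero    _  quot = trans (cong +_ quot) (zero-case (trans (sym quot) (ℕ.0/n≡0 d)))
    where
    zero-case : ∀ {n} → n ≡ 0 → + n ≡ ℤ.- + n
    zero-case refl = refl
  lemma (suc x) rem quot with suc x ℕ.% d | rem
  ... | zero | _ = cong (ℤ.-_ ∘ +_) quot

ceiling-multiple : ∀ n → ceiling ((+ (30 + n * 28) ℤ.- + 30) / 28) ≡ + n
ceiling-multiple n = begin
  ceiling ((+ (30 + n * 28) ℤ.- + 30) / 28)   ≡⟨ cong ℤ.-_ (ℤ.*-identityˡ _) ⟩
  ℤ.- ((ℤ.- + (n * 28)) ℤ./ℕ 28)               ≡⟨ cong ℤ.-_ (-[n*d]/d n 28) ⟩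
  ℤ.- (ℤ.- + n)                               ≡⟨ ℤ.neg-involutive (+ n) ⟩
  + n                                         ∎
  where open ≡-Reasoning

-- The graph, its Euler genus and its colorings

module Example (n : ℕ) where

  P : Patch (suc n)
  P = patch (suc n)

  module P = Patch P

  open CloseUp P
  open Realise triangulation

  G : Graph
  G = toGraph

  -- With `suc n` tiles at each hub the Euler genus is 28(n + 1) + 2, and the third color allows `n`
  -- like neighbours, one fewer than there are tiles.
  g : ℕ
  g = 30 + n * 28

  vertexAt : Vertex → Fin (Graph.order toGraph)
  vertexAt = Inverse.from (Triangulation.Vertex↔ triangulation)

  x₀ : Triangulation.Flag triangulation
  x₀ = inj₂ (0F , inj₁ 0F) , 0F , false

  M : Map
  M = toMap x₀

  -- A closed walk of 23 steps along a Möbius band in the outermost tile of copy 0, through the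
  -- triangles 024, 124, 145, 457, 579, 589, 489 and 049.
  loop : List (Fin 3)
  loop = 0F ∷ 1F ∷ 0F ∷ 2F ∷ 1F ∷ 2F ∷ 1F ∷ 0F ∷ 2F ∷ 1F ∷ 2F ∷ 1F ∷
         0F ∷ 2F ∷ 1F ∷ 2F ∷ 1F ∷ 0F ∷ 2F ∷ 1F ∷ 0F ∷ 2F ∷ 1F ∷ []

  M-nonOrientable : ¬ Map.Orientable M
  M-nonOrientable = nonOrientable x₀ x₀ loop refl refl

  M-χ : Map.χ M ≡ + 2 ℤ.- + g
  M-χ = euler⁺ (7 + 7 * (suc n * 8 + 0)) (7 * (3 + (suc n * 36 + 0))) (7 + 7 * (suc n * 24 + 1)) g
    (solve 1 (λ n → con 7 :+ con 7 :* ((con 1 :+ n) :* con 8 :+ con 0) :+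
                    (con 7 :+ con 7 :* ((con 1 :+ n) :* con 24 :+ con 1)) :+ (con 30 :+ n :* con 28)
       := con 2 :+ con 7 :* (con 3 :+ ((con 1 :+ n) :* con 36 :+ con 0))) refl n)
    where open ℕ-Solver

  embeds : G EmbedsIn sphereWithCrossCaps g
  embeds = M , (M-nonOrientable , M-χ) , isSubgraph x₀

  minimal : ∀ S → G EmbedsIn S → g ≤ eulerGenus S
  minimal S (M′ , onS , sub) = ℕ.*-cancelˡ-≤ 3 (ℕ.+-cancelˡ-≤ (3 * #V) _ _ (begin
    3 * #V + 3 * g
      -- The triangulation attains equality in the edge bound, so comparison with any other surface
      -- cancels to an inequality of genera.
      ≡⟨ solve 1 (λ n → con 3 :* (con 7 :+ con 7 :* ((con 1 :+ n) :* con 8 :+ con 0)) :+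
                        con 3 :* (con 30 :+ n :* con 28)
       := con 6 :+ con 7 :* (con 3 :+ ((con 1 :+ n) :* con 36 :+ con 0))) refl n ⟩
    6 + 7 * (3 + (suc n * 36 + 0))
      ≤⟨ edge-bound (ℕ.m≤m+n 3 _) (eulerGenus S)
           (euler⁻ (Map.cells M′ 0F) (Map.cells M′ 1F) _ _ (isMapOn⇒χ S onS)) ⟩
    3 * #V + 3 * eulerGenus S ∎))
    where
    #V : ℕ
    #V = 7 + 7 * (suc n * 8 + 0)
    open ℕ.≤-Reasoning
    open ℕ-Solver
    open EdgeBound G M′ sub tailAt headAt (λ k → k , inj₁ (refl , refl)) distinctAt orientedAt
    open Count (Cellular.dualForest M′ unkept)

  not-colourable : ¬ Colorable G (+ 2 ∷ + 2 ∷ + n ∷ [])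
  not-colourable (c , ok) = ℕ.<-irrefl refl (ℕ.≤-trans like few)
    where
    third : ∃[ h ] c (vertexAt (inj₁ h)) ≡ 2F
    third = third-colour G ok (vertexAt ∘ inj₁) λ s≢t → link⇒adj (hubs-linked s≢t)
    h : Fin 7
    h = proj₁ third
    member : Fin (suc n) → Fin 7 → Fin (Graph.order G)
    member j s = vertexAt (inj₂ (h , P.clique j s))
    thirds : ∀ j → ∃[ s ] c (member j s) ≡ 2F
    thirds j = third-colour G ok (member j) λ s≢t → link⇒adj (chord h j s≢t)
    like : suc n ≤ likeNeighbours G c (vertexAt (inj₁ h))
    like = likeNeighbours-≥ G c (vertexAt (inj₁ h)) (λ j → member j (proj₁ (thirds j)))
      -- The copies of K₇ in different tiles are disjoint, so the chosen neighbours are distinct.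
      (λ {i} {j} eq → proj₁ (P.cliques {i} {j} {proj₁ (thirds i)} {proj₁ (thirds j)}
        (proj₂ (,-injective (Sum.inj₂-injective
          (Vertex-injective {inj₂ (h , P.clique i (proj₁ (thirds i)))} {inj₂ (h , P.clique j (proj₁ (thirds j)))} eq))))))
      (λ j → link⇒adj (spoke h (P.clique j (proj₁ (thirds j)))))
      (λ j → trans (proj₂ (thirds j)) (sym (proj₂ third)))
    few : likeNeighbours G c (vertexAt (inj₁ h)) ≤ n
    few = ℤ.drop‿+≤+ (subst
      (λ x → + likeNeighbours G c (vertexAt (inj₁ h)) ℤ.≤ lookup (+ 2 ∷ + 2 ∷ + n ∷ []) x)
      (proj₂ third) (ok (vertexAt (inj₁ h))))

mainTheorem8 : ∀ (N : ℕ) → ∃[ g ] N < g × (∃[ G ] HasEulerGenus G g × ¬ Colorable G (+ 2 ∷ + 2 ∷ ceiling ((+ g ℤ.- + 30) / 28) ∷ []))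
mainTheorem8 n = g , large , G , ((sphereWithCrossCaps g , embeds , refl) , minimal) ,
  subst (λ d → ¬ Colorable G (+ 2 ∷ + 2 ∷ d ∷ [])) (sym (ceiling-multiple n)) not-colourable
  where
  open Example n
  large : n < 30 + n * 28
  large = ℕ.s≤s (ℕ.≤-trans (ℕ.m≤m*n n 28) (ℕ.m≤n+m _ 29))
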